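{- The $k$-\textsc{Compatible Bounded Ordering} problem is $\mathsf{W[1]}$-hard when parameterized by $b$.
   Context: For a positive integer $k$, write $[k]=\{1,\dots,k\}$. An instance of $k$-\textsc{Compatible Bounded Ordering} consists of a finite vertex set $V$, a collection $\mathcal{G}$ of $k$ pairs of directed graphs $(A_1,B_1),\dots,(A_k,B_k)$ with $V(A_i)=V(B_i)=V$ for all $i\in[k]$, and a natural number $b$. It is a yes-instance if and only if there exist an integer $b'\ge b$, distinct vertices $s_1,\dots,s_{b'}\in V$ and labels $\ell_1,\dots,\ell_{b'}\in[k]$ such that for every $i\in[b']$: (i) $s_i$ is a sink in $A_{\ell_i}[\{s_i,\dots,s_{b'}\}]$, i.e., $s_i$ has no out-neighbor in $A_{\ell_i}$ among $s_{i+1},\dots,s_{b'}$; and (ii) $s_i$ is a source in $B_{\ell_i}[\{s_1,\dots,s_i\}]$, i.e., $s_i$ has no in-neighbor in $B_{\ell_i}$ among $s_1,\dots,s_{i-1}$. -}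

module Defs where

open import Data.Bool.Base using (Bool; true; false)
open import Data.Fin.Base using (Fin; _<_; toℕ)
open import Data.Fin.Subset using (Subset; _∈_; _∉_; ∣_∣)
open import Data.List.Base using (List; []; _∷_; map; tabulate; length)
open import Data.List.Relation.Unary.All using (All)
open import Data.List.Relation.Unary.Any using (Any)
open import Data.Nat.Base using (ℕ; zero; suc; _+_; _*_; _^_; _≤_)
open import Data.Product.Base using (∃-syntax; _×_; _,_; proj₁; proj₂)
open import Function.Bundles using (_⇔_)
open import Function.Definitions using (Injective)
open import Relation.Binary.PropositionalEquality using (_≡_)

------------------------------------------------------------------------
-- Model of computation: a structured while-language over binary trees (in
-- the style of Jones's WHILE), in which a program transforms one tree.

data 𝔻 : Set where
  nil  : 𝔻
  cons : 𝔻 → 𝔻 → 𝔻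

size : 𝔻 → ℕ
size nil        = 1
size (cons x y) = 1 + size x + size y

infixr 5 _⨾_

data Prog : Set where
  skip const-nil hd tl : Prog
  _⨾_                  : Prog → Prog → Prog
  pair                 : Prog → Prog → Prog
  if_then_else_        : Prog → Prog → Prog → Prog
  while_loop_          : Prog → Prog → Prog

head tail : 𝔻 → 𝔻
head nil        = nil
head (cons x _) = x
tail nil        = nil
tail (cons _ y) = y

-- p ⊢ x ⇓[ t ] y: program p, started on x, halts with result y in time t.
-- A test is a program that is run on a copy of the current tree; it fails iff
-- its result is nil.  Every step that inspects, copies or discards a tree is
-- charged the full size of that tree, so that the size of a result never
-- exceeds the time spent, subtree sharing gives no advantage, and time is
-- polynomially related to Turing machine time in both directions.

infix 4 _⊢_⇓[_]_

data _⊢_⇓[_]_ : Prog → 𝔻 → ℕ → 𝔻 → Set where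
  ⇓skip : ∀ {x} → skip ⊢ x ⇓[ size x ] x
  ⇓nil  : ∀ {x} → const-nil ⊢ x ⇓[ size x ] nil
  ⇓hd   : ∀ {x} → hd ⊢ x ⇓[ size x ] head x
  ⇓tl   : ∀ {x} → tl ⊢ x ⇓[ size x ] tail x
  ⇓seq  : ∀ {p q x y z s t} →
          p ⊢ x ⇓[ s ] y → q ⊢ y ⇓[ t ] z →
          p ⨾ q ⊢ x ⇓[ s + t ] z
  ⇓pair : ∀ {p q x y z s t} →
          p ⊢ x ⇓[ s ] y → q ⊢ x ⇓[ t ] z →
          pair p q ⊢ x ⇓[ size x + s + t ] cons y z
  ⇓then : ∀ {e p q x a b y s t} →
          e ⊢ x ⇓[ s ] cons a b → p ⊢ x ⇓[ t ] y →
          if e then p else q ⊢ x ⇓[ size x + s + t ] y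
  ⇓else : ∀ {e p q x y s t} →
          e ⊢ x ⇓[ s ] nil → q ⊢ x ⇓[ t ] y →
          if e then p else q ⊢ x ⇓[ size x + s + t ] y
  ⇓stop : ∀ {e p x s} →
          e ⊢ x ⇓[ s ] nil →
          while e loop p ⊢ x ⇓[ size x + s ] x
  ⇓step : ∀ {e p x a b y z s t u} →
          e ⊢ x ⇓[ s ] cons a b → p ⊢ x ⇓[ t ] y → while e loop p ⊢ y ⇓[ u ] z →
          while e loop p ⊢ x ⇓[ size x + s + t + u ] z

⌜_⌝ℕ : ℕ → 𝔻
⌜ zero ⌝ℕ  = nil
⌜ suc n ⌝ℕ = cons nil ⌜ n ⌝ℕ

⌜_⌝𝔹 : Bool → 𝔻
⌜ false ⌝𝔹 = nil
⌜ true ⌝𝔹  = cons nil nil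

⌜_⌝Fin : ∀ {n} → Fin n → 𝔻
⌜ i ⌝Fin = ⌜ toℕ i ⌝ℕ

⌜_⌝List : List 𝔻 → 𝔻
⌜ [] ⌝List     = nil
⌜ x ∷ xs ⌝List = cons x ⌜ xs ⌝List

Computable : (ℕ → ℕ) → Set
Computable f = ∃[ p ] ∀ n → ∃[ t ] p ⊢ ⌜ n ⌝ℕ ⇓[ t ] ⌜ f n ⌝ℕ

------------------------------------------------------------------------
-- Parameterized problems and reductions

-- An instance of the parameterized problem is a pair (x , k) of an instance x
-- of the underlying problem and the parameter k.

record ParameterizedProblem : Set₁ where
  field
    Instance : Set
    encode   : Instance → 𝔻
    Yes      : Instance → ℕ → Set

  input : Instance × ℕ → 𝔻
  input (x , k) = cons (encode x) ⌜ k ⌝ℕ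

open ParameterizedProblem

-- Running time is bounded by f(k)·|x|ᶜ and the new parameter by g(k).

infix 4 _≤fpt_

record _≤fpt_ (P Q : ParameterizedProblem) : Set where
  field
    reduce       : Instance P × ℕ → Instance Q × ℕ
    correct      : ∀ x k → let (y , l) = reduce (x , k) in Yes P x k ⇔ Yes Q y l

    g            : ℕ → ℕ
    g-computable : Computable g
    g-bound      : ∀ x k → proj₂ (reduce (x , k)) ≤ g k

    f            : ℕ → ℕ
    f-computable : Computable f
    c            : ℕ
    program      : Prog
    runs         : ∀ x k → ∃[ t ] t ≤ f k * size (encode P x) ^ c ×
                   program ⊢ input P (x , k) ⇓[ t ] input Q (reduce (x , k))

------------------------------------------------------------------------
-- The class W[1], as the union over d of the fpt-closures of the weighted
-- satisfiability problem for formulas in d-CNF.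

data Literal (n : ℕ) : Set where
  pos neg : Fin n → Literal n

Clause : ℕ → Set
Clause n = List (Literal n)

record CNF (d : ℕ) : Set where
  field
    vars    : ℕ
    clauses : List (Clause vars)
    width   : All (λ C → length C ≤ d) clauses

-- A truth assignment is given by the set of variables it makes true, so that
-- its weight is the cardinality of that set.

Satisfies : ∀ {n} → Subset n → Literal n → Set
Satisfies S (pos x) = x ∈ S
Satisfies S (neg x) = x ∉ S

⌜_⌝Lit : ∀ {n} → Literal n → 𝔻
⌜ pos x ⌝Lit = cons ⌜ true ⌝𝔹 ⌜ x ⌝Fin
⌜ neg x ⌝Lit = cons ⌜ false ⌝𝔹 ⌜ x ⌝Fin

WSat : ℕ → ParameterizedProblem
WSat d = record
  { Instance = CNF d
  ; encode   = λ φ → let open CNF φ in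
      cons ⌜ vars ⌝ℕ ⌜ map (λ C → ⌜ map ⌜_⌝Lit C ⌝List) clauses ⌝List
  ; Yes      = λ φ k → let open CNF φ in
      ∃[ S ] ∣ S ∣ ≡ k × All (Any (Satisfies S)) clauses
  }

W[1] : ParameterizedProblem → Set
W[1] P = ∃[ d ] P ≤fpt WSat d

W[1]-hard : ParameterizedProblem → Set₁
W[1]-hard Q = ∀ P → W[1] P → P ≤fpt Q

------------------------------------------------------------------------
-- Compatible Bounded Ordering

record Digraph (n : ℕ) : Set where
  field
    arc      : Fin n → Fin n → Bool
    loopless : ∀ v → arc v v ≡ false

open Digraph

⌜_⌝Digraph : ∀ {n} → Digraph n → 𝔻
⌜ G ⌝Digraph =
  ⌜ tabulate (λ u → ⌜ tabulate (λ v → ⌜ arc G u v ⌝𝔹) ⌝List) ⌝List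

record DigraphPairs (k : ℕ) : Set where
  field
    order : ℕ
    A B   : Fin k → Digraph order

-- The vertices s i and labels ℓ i are indexed from 0.

record CompatibleOrdering {k} (𝒢 : DigraphPairs k) (b′ : ℕ) : Set where
  open DigraphPairs 𝒢
  field
    s        : Fin b′ → Fin order
    distinct : Injective _≡_ _≡_ s
    ℓ        : Fin b′ → Fin k
    sink     : ∀ i j → i < j → arc (A (ℓ i)) (s i) (s j) ≡ false
    source   : ∀ i j → j < i → arc (B (ℓ i)) (s j) (s i) ≡ false

-- The number k of pairs is fixed; the bound b is the parameter.

CompatibleBoundedOrdering : ℕ → ParameterizedProblem
CompatibleBoundedOrdering k = record
  { Instance = DigraphPairs k
  ; encode   = λ 𝒢 → let open DigraphPairs 𝒢 in
      cons ⌜ order ⌝ℕ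
           ⌜ tabulate (λ i → cons ⌜ A i ⌝Digraph ⌜ B i ⌝Digraph) ⌝List
  ; Yes      = λ 𝒢 b → ∃[ b′ ] b ≤ b′ × CompatibleOrdering 𝒢 b′
  }

{-# OPTIONS --safe #-}
module Submission where

-- If all pairs consist of the same symmetric graph, a compatible ordering is
-- an independent set, so it suffices to turn weighted d-CNF satisfiability
-- into independent set.  A set S of k among n variables is the concatenation
-- of k + 1 blocks: block i is a pair (aᵢ , bᵢ) such that the variables in
-- [aᵢ , bᵢ) are false and, for i < k, bᵢ is true and aᵢ₊₁ = bᵢ + 1; moreover
-- a₀ = 0 and b_k = n.  The point is that now every literal, positive or
-- negative, is false if and only if a single block witnesses this, so that a
-- violated clause is witnessed by at most d blocks.  With D = d + 1, the
-- vertices are the D-tuples of blocks that are consistent and violate no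
-- clause, and inconsistent tuples are adjacent.  Tuples of blocks with the same
-- D indices are adjacent, so an independent set of size (k + 1)^D contains
-- exactly one tuple for each choice of indices and hence determines S.

open import Defs
open import Data.Bool.Base as Bool using (Bool; true; false; _∧_; _∨_; not; T)
open import Data.Bool.Properties using (if-float)
open import Data.Fin.Base using (Fin; zero; suc; toℕ)
import Data.Fin.Properties as Fin
open import Data.Fin.Subset using (Subset; inside; outside; _∈_; _∉_; ∣_∣)
open import Data.Fin.Subset.Properties using (_∈?_)
open import Data.List.Base using (List; []; _∷_; [_]; _++_; _ʳ++_; map; concatMap; filter;
  foldl; foldr; reverse; replicate; length; lookup; tabulate; cartesianProduct; cartesianProductWith; downFrom)
open import Data.List.Properties using (reverse-foldr; reverse-involutive; ∷-injective; ∷-injectiveˡ;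
  ∷-injectiveʳ; map-∘; map-id; map-cong; map-tabulate; tabulate-lookup; length-map; length-++; length-replicate;
  length-downFrom)
import Data.List.Membership.Propositional as List
open import Data.List.Membership.Propositional.Properties using (∈-map⁺; ∈-map⁻; ∈-filter⁺; ∈-filter⁻; ∈-lookup;
  ∈-cartesianProduct⁺; ∈-cartesianProduct⁻; ∈-cartesianProductWith⁺; ∈-cartesianProductWith⁻;
  ∈-downFrom⁺; ∈-downFrom⁻)
open import Data.List.Membership.Setoid.Properties using (index-injective)
open import Data.List.Relation.Unary.All as All using (All; []; _∷_; all?)
import Data.List.Relation.Unary.All.Properties as All
open import Data.List.Relation.Unary.AllPairs using ([]; _∷_)
open import Data.List.Relation.Unary.Any as Any using (Any; here; there; any?)
import Data.List.Relation.Unary.Any.Properties as Any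
open import Data.List.Relation.Unary.Unique.Propositional using (Unique)
import Data.List.Relation.Unary.Unique.Propositional.Properties as Unique
open import Data.Nat.Base using (ℕ; zero; suc; pred; NonZero;
  _+_; _*_; _∸_; _^_; _⊓_; _≤_; _<_; _≡ᵇ_; z≤n; s≤s; s≤s⁻¹)
open import Data.Nat.Properties
open import Data.Nat.Tactic.RingSolver using (solve-∀)
open import Data.Product.Base using (∃-syntax; _×_; _,_; proj₁; proj₂)
open import Data.Sum.Base using (_⊎_; inj₁; inj₂)
open import Data.Unit.Base using (⊤; tt)
open import Data.Vec.Base as Vec using ([]; _∷_)
open import Function.Base using (_∘_; id)
open import Function.Bundles using (_⇔_; mk⇔)
open import Function.Construct.Composition using (_⇔-∘_)
open import Function.Definitions using (Injective)
open import Relation.Binary.Definitions using (tri<; tri≈; tri>)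
open import Relation.Binary.PropositionalEquality
  using (_≡_; _≢_; refl; sym; trans; cong; cong₂; subst; subst₂; setoid)
open import Relation.Nullary.Decidable using (Dec; yes; no; does; does-⇔; dec-true; dec-false; decidable-stable;
  T?; ¬?; _×-dec_; _⊎-dec_)
open import Relation.Nullary.Negation using (¬_; contradiction)

-- Polynomial time bounds

infixl 6 _⊕_
infixl 7 _⊗_
infixr 8 _⊙_

-- Bounds are kept as syntax, so that monotonicity and a degree can be obtained by recursion.
-- Composition is a constructor because running one program on the output of another composes their
-- time bounds.
data Bound : Set where
  var         : Bound
  con         : ℕ → Bound
  _⊕_ _⊗_ _⊙_ : Bound → Bound → Bound

⟦_⟧ : Bound → ℕ → ℕ
⟦ var ⟧   n = n
⟦ con c ⟧ n = c
⟦ p ⊕ q ⟧ n = ⟦ p ⟧ n + ⟦ q ⟧ n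
⟦ p ⊗ q ⟧ n = ⟦ p ⟧ n * ⟦ q ⟧ n
⟦ p ⊙ q ⟧ n = ⟦ p ⟧ (⟦ q ⟧ n)

⟦⟧-mono : ∀ p {m n} → m ≤ n → ⟦ p ⟧ m ≤ ⟦ p ⟧ n
⟦⟧-mono var     m≤n = m≤n
⟦⟧-mono (con c) m≤n = ≤-refl
⟦⟧-mono (p ⊕ q) m≤n = +-mono-≤ (⟦⟧-mono p m≤n) (⟦⟧-mono q m≤n)
⟦⟧-mono (p ⊗ q) m≤n = *-mono-≤ (⟦⟧-mono p m≤n) (⟦⟧-mono q m≤n)
⟦⟧-mono (p ⊙ q) m≤n = ⟦⟧-mono p (⟦⟧-mono q m≤n)

-- An exponent for the base `2 + n` that needs no leading coefficient. As the base is at least 2, a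
-- constant c is absorbed by c ≤ 2 ^ c, and a sum costs one extra factor. In a composition the new
-- base `2 + ⟦ q ⟧ n` is itself such a sum, with the 2 counted as degree 1.
degree : Bound → ℕ
degree var     = 1
degree (con c) = c
degree (p ⊕ q) = suc (degree p + degree q)
degree (p ⊗ q) = degree p + degree q
degree (p ⊙ q) = suc (suc (degree q)) * degree p

n≤[2+m]^n : ∀ m n → n ≤ (2 + m) ^ n
n≤[2+m]^n m zero    = z≤n
n≤[2+m]^n m (suc n) = begin
  1 + n                          ≤⟨ +-mono-≤ (m^n>0 (2 + m) n) (n≤[2+m]^n m n) ⟩
  (2 + m) ^ n + (2 + m) ^ n      ≤⟨ +-monoʳ-≤ ((2 + m) ^ n) (m≤m+n ((2 + m) ^ n) _) ⟩
  (2 + m) ^ suc n                ∎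
  where open ≤-Reasoning

+-≤-^ : ∀ m c d {x y} → x ≤ (2 + m) ^ c → y ≤ (2 + m) ^ d → x + y ≤ (2 + m) ^ suc (c + d)
+-≤-^ m c d {x} {y} x≤ y≤ = begin
  x + y                                ≤⟨ +-mono-≤ (≤-trans x≤ (^-monoʳ-≤ (2 + m) (m≤m+n c d)))
                                                   (≤-trans y≤ (^-monoʳ-≤ (2 + m) (m≤n+m d c))) ⟩
  (2 + m) ^ (c + d) + (2 + m) ^ (c + d) ≤⟨ +-monoʳ-≤ ((2 + m) ^ (c + d)) (m≤m+n ((2 + m) ^ (c + d)) _) ⟩
  (2 + m) ^ suc (c + d)                ∎
  where open ≤-Reasoning

⟦⟧≤^degree : ∀ p n → ⟦ p ⟧ n ≤ (2 + n) ^ degree p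
⟦⟧≤^degree var     n = ≤-trans (m≤n+m n 2) (≤-reflexive (sym (^-identityʳ (2 + n))))
⟦⟧≤^degree (con c) n = n≤[2+m]^n n c
⟦⟧≤^degree (p ⊕ q) n = +-≤-^ n (degree p) (degree q) (⟦⟧≤^degree p n) (⟦⟧≤^degree q n)
⟦⟧≤^degree (p ⊗ q) n = ≤-trans (*-mono-≤ (⟦⟧≤^degree p n) (⟦⟧≤^degree q n))
  (≤-reflexive (sym (^-distribˡ-+-* (2 + n) (degree p) (degree q))))
⟦⟧≤^degree (p ⊙ q) n = begin
  ⟦ p ⟧ (⟦ q ⟧ n)                              ≤⟨ ⟦⟧≤^degree p (⟦ q ⟧ n) ⟩
  (2 + ⟦ q ⟧ n) ^ degree p
    ≤⟨ ^-monoˡ-≤ (degree p) (+-≤-^ n 1 (degree q) 2≤ (⟦⟧≤^degree q n)) ⟩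
  ((2 + n) ^ suc (suc (degree q))) ^ degree p  ≡⟨ ^-*-assoc (2 + n) (suc (suc (degree q))) (degree p) ⟩
  (2 + n) ^ degree (p ⊙ q)                     ∎
  where
  open ≤-Reasoning
  2≤ : 2 ≤ (2 + n) ^ 1
  2≤ = ≤-trans (m≤m+n 2 n) (≤-reflexive (sym (^-identityʳ (2 + n))))

-- Tree sizes and programs that run in polynomial time

1≤size : ∀ x → 1 ≤ size x
1≤size nil        = ≤-refl
1≤size (cons x y) = s≤s z≤n

size-head : ∀ x → size (head x) ≤ size x
size-head nil        = ≤-refl
size-head (cons x y) = ≤-trans (m≤m+n (size x) (size y)) (n≤1+n _)

size-tail : ∀ x → size (tail x) ≤ size x
size-tail nil        = ≤-refl
size-tail (cons x y) = ≤-trans (m≤n+m (size y) (size x)) (n≤1+n _)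

-- Each step is charged the full size of the tree it touches. Hence a time bound also bounds the
-- input of whatever program runs next, which is why polynomial time is closed under composition.
size≤time : ∀ {p x t y} → p ⊢ x ⇓[ t ] y → size y ≤ t
size≤time ⇓skip            = ≤-refl
size≤time (⇓nil {x})       = 1≤size x
size≤time (⇓hd {x})        = size-head x
size≤time (⇓tl {x})        = size-tail x
size≤time (⇓seq {s = s} _ d) = ≤-trans (size≤time d) (m≤n+m _ s)
size≤time (⇓pair {x = x} d e) = +-mono-≤ (+-mono-≤ (1≤size x) (size≤time d)) (size≤time e)
size≤time (⇓then {x = x} {s = s} _ d) = ≤-trans (size≤time d) (m≤n+m _ (size x + s))
size≤time (⇓else {x = x} {s = s} _ d) = ≤-trans (size≤time d) (m≤n+m _ (size x + s))
size≤time (⇓stop {x = x} {s = s} _)   = m≤m+n (size x) s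
size≤time (⇓step {x = x} {s = s} {t = t} _ _ d) = ≤-trans (size≤time d) (m≤n+m _ (size x + s + t))

infix 4 _⇝_

-- A single program computing o x from i x for all x, in time polynomial in
-- the size of i x.
record _⇝_ {X : Set} (i o : X → 𝔻) : Set where
  field
    prog : Prog
    time : Bound
    run  : ∀ x → ∃[ t ] t ≤ ⟦ time ⟧ (size (i x)) × prog ⊢ i x ⇓[ t ] o x

open _⇝_

module _ {X : Set} {i : X → 𝔻} where

  ⇝-id : i ⇝ i
  ⇝-id = record { prog = skip ; time = var ; run = λ x → _ , ≤-refl , ⇓skip }

  ⇝-nil : i ⇝ λ _ → nil
  ⇝-nil = record { prog = const-nil ; time = var ; run = λ x → _ , ≤-refl , ⇓nil }

  ⇝-head : i ⇝ head ∘ i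
  ⇝-head = record { prog = hd ; time = var ; run = λ x → _ , ≤-refl , ⇓hd }

  ⇝-tail : i ⇝ tail ∘ i
  ⇝-tail = record { prog = tl ; time = var ; run = λ x → _ , ≤-refl , ⇓tl }

  infixr 5 _⇝⨾_

  _⇝⨾_ : ∀ {m o : X → 𝔻} → i ⇝ m → m ⇝ o → i ⇝ o
  p ⇝⨾ q = record
    { prog = prog p ⨾ prog q
    ; time = time p ⊕ time q ⊙ time p
    ; run  = λ x →
        let s , s≤ , d = run p x
            t , t≤ , e = run q x
        in s + t , +-mono-≤ s≤ (≤-trans t≤ (⟦⟧-mono (time q) (≤-trans (size≤time d) s≤))) , ⇓seq d e
    }

  ⇝-pair : ∀ {o₁ o₂ : X → 𝔻} → i ⇝ o₁ → i ⇝ o₂ → i ⇝ λ x → cons (o₁ x) (o₂ x)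
  ⇝-pair p q = record
    { prog = pair (prog p) (prog q)
    ; time = var ⊕ time p ⊕ time q
    ; run  = λ x →
        let s , s≤ , d = run p x
            t , t≤ , e = run q x
        in _ , +-mono-≤ (+-monoʳ-≤ (size (i x)) s≤) t≤ , ⇓pair d e
    }

  ⇝-if : ∀ {b : X → Bool} {o₁ o₂ : X → 𝔻} → i ⇝ (λ x → ⌜ b x ⌝𝔹) → i ⇝ o₁ → i ⇝ o₂ →
         i ⇝ λ x → Bool.if b x then o₁ x else o₂ x
  ⇝-if {b} {o₁} {o₂} c p q = record
    { prog = if prog c then prog p else prog q
    ; time = var ⊕ time c ⊕ (time p ⊕ time q)
    ; run  = run-if
    }
    where
    run-if : ∀ x → ∃[ t ] t ≤ ⟦ var ⊕ time c ⊕ (time p ⊕ time q) ⟧ (size (i x)) ×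
             if prog c then prog p else prog q ⊢ i x ⇓[ t ] (Bool.if b x then o₁ x else o₂ x)
    run-if x with b x | run c x
    ... | true  | s , s≤ , d = let t , t≤ , e = run p x in
      _ , +-mono-≤ (+-monoʳ-≤ (size (i x)) s≤) (≤-trans t≤ (m≤m+n _ _)) , ⇓then d e
    ... | false | s , s≤ , d = let t , t≤ , e = run q x in
      _ , +-mono-≤ (+-monoʳ-≤ (size (i x)) s≤) (≤-trans t≤ (m≤n+m _ _)) , ⇓else d e

⇝-∘ : ∀ {X Y : Set} {i o : X → 𝔻} → i ⇝ o → (h : Y → X) → i ∘ h ⇝ o ∘ h
⇝-∘ p h = record { prog = prog p ; time = time p ; run = run p ∘ h }

⇝-ext : ∀ {X : Set} {i i′ o o′ : X → 𝔻} → (∀ x → i x ≡ i′ x) → (∀ x → o x ≡ o′ x) → i ⇝ o → i′ ⇝ o′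
⇝-ext eqᵢ eqₒ p = record
  { prog = prog p
  ; time = time p
  ; run  = λ x → subst₂ (λ u v → ∃[ t ] t ≤ ⟦ time p ⟧ (size u) × prog p ⊢ u ⇓[ t ] v) (eqᵢ x) (eqₒ x) (run p x)
  }

-- Typed data and loops over lists

infixr 6 _`×_

data Ty : Set where
  unit bool nat : Ty
  _`×_          : Ty → Ty → Ty
  list          : Ty → Ty

El : Ty → Set
El unit     = ⊤
El bool     = Bool
El nat      = ℕ
El (σ `× τ) = El σ × El τ
El (list τ) = List (El τ)

enc : ∀ τ → El τ → 𝔻
enc unit     _       = nil
enc bool     b       = ⌜ b ⌝𝔹
enc nat      n       = ⌜ n ⌝ℕ
enc (σ `× τ) (x , y) = cons (enc σ x) (enc τ y)
enc (list τ) xs      = ⌜ map (enc τ) xs ⌝List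

size-enc : ∀ τ → El τ → ℕ
size-enc τ x = size (enc τ x)

record PolyTime (Γ τ : Ty) (F : El Γ → El τ) : Set where
  constructor polyTime
  field
    computes : enc Γ ⇝ enc τ ∘ F

open PolyTime

module Fold {ε α β : Ty} {step : El (ε `× (α `× β)) → El β} (P : PolyTime (ε `× (α `× β)) β step) where

  state : El ε → List (El α) → El β → 𝔻
  state e xs b = enc (ε `× (list α `× β)) (e , xs , b)

  iterate : El ε → List (El α) → El β → El β
  iterate e xs b = foldl (λ b a → step (e , a , b)) b xs

  -- M bounds every state that the loop visits. A polynomial bound for a single step would not
  -- suffice, since the accumulator could grow exponentially under iteration.
  Bounded : ℕ → El ε → List (El α) → El β → Set
  Bounded M e []       b = size (state e [] b) ≤ M
  Bounded M e (x ∷ xs) b = size (state e (x ∷ xs) b) ≤ M × Bounded M e xs (step (e , x , b))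

  private
    Step : Set
    Step = El ε × El α × List (El α) × El β

    body : (λ ((e , x , xs , b) : Step) → state e (x ∷ xs) b) ⇝
           (λ ((e , x , xs , b) : Step) → state e xs (step (e , x , b)))
    body = ⇝-pair ⇝-head (⇝-pair (⇝-tail ⇝⨾ ⇝-head ⇝⨾ ⇝-tail)
      (⇝-pair ⇝-head (⇝-pair (⇝-tail ⇝⨾ ⇝-head ⇝⨾ ⇝-head) (⇝-tail ⇝⨾ ⇝-tail)) ⇝⨾
       ⇝-∘ (computes P) (λ ((e , x , xs , b) : Step) → e , x , b)))

    -- The remaining list serves as its own test, because only the empty list is encoded by `nil`.
    test : (λ ((e , xs , b) : El ε × List (El α) × El β) → state e xs b) ⇝ λ (e , xs , b) → enc (list α) xs
    test = ⇝-tail ⇝⨾ ⇝-head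

    loop : Prog
    loop = while prog test loop prog body

    cost : Bound
    cost = var ⊕ time test ⊕ time body

    -- There is one round per element, and one more test that fails at the end. By monotonicity each
    -- of them costs at most `⟦ cost ⟧ M`.
    run-loop : ∀ M e xs b → Bounded M e xs b →
               ∃[ t ] t ≤ suc (length xs) * ⟦ cost ⟧ M × loop ⊢ state e xs b ⇓[ t ] state e [] (iterate e xs b)
    run-loop M e [] b ≤M =
      let s , s≤ , d = run test (e , [] , b)
      in _ , ≤-trans (+-mono-≤ ≤M (≤-trans s≤ (⟦⟧-mono (time test) ≤M)))
               (≤-trans (m≤m+n _ _) (m≤m+n _ _)) , ⇓stop d
    run-loop M e (x ∷ xs) b (≤M , bounded) =
      let s , s≤ , c = run test (e , x ∷ xs , b)
          t , t≤ , d = run body (e , x , xs , b)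
          u , u≤ , r = run-loop M e xs (step (e , x , b)) bounded
      in _ , +-mono-≤ (+-mono-≤ (+-mono-≤ ≤M (≤-trans s≤ (⟦⟧-mono (time test) ≤M)))
                                 (≤-trans t≤ (⟦⟧-mono (time body) ≤M))) u≤ , ⇓step c d r

  length≤size : ∀ xs → suc (length xs) ≤ size-enc (list α) xs
  length≤size []       = ≤-refl
  length≤size (x ∷ xs) = s≤s (≤-trans (length≤size xs) (m≤n+m _ (size-enc α x)))

  polyTime-iterate : ∀ {X : Set} (e : X → El ε) (xs : X → List (El α)) (b : X → El β) (m : Bound) →
    (∀ x → Bounded (⟦ m ⟧ (size (state (e x) (xs x) (b x)))) (e x) (xs x) (b x)) →
    (λ x → state (e x) (xs x) (b x)) ⇝ λ x → enc β (iterate (e x) (xs x) (b x))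
  polyTime-iterate e xs b m bounded = loop′ ⇝⨾ ⇝-tail ⇝⨾ ⇝-tail
    where
    loop′ : (λ x → state (e x) (xs x) (b x)) ⇝ λ x → state (e x) [] (iterate (e x) (xs x) (b x))
    loop′ = record
      { prog = loop
      -- The list is part of the initial state, so the size of that state bounds the number of
      -- rounds.
      ; time = var ⊗ (cost ⊙ m)
      ; run  = λ x →
          let t , t≤ , d = run-loop _ (e x) (xs x) (b x) (bounded x)
          in t , ≤-trans t≤ (*-monoˡ-≤ _ (≤-trans (length≤size (xs x))
                   (≤-trans (size-head (tail (state (e x) (xs x) (b x))))
                            (size-tail (state (e x) (xs x) (b x)))))) , d
      }

-- Elements move from one list to the other unchanged; the successor accounts for the second
-- terminating `nil`.
size-ʳ++ : ∀ τ (xs ys : List (El τ)) →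
  suc (size-enc (list τ) (xs ʳ++ ys)) ≡ size-enc (list τ) xs + size-enc (list τ) ys
size-ʳ++ τ []       ys = refl
size-ʳ++ τ (x ∷ xs) ys = trans (size-ʳ++ τ xs (x ∷ ys))
  (lemma (size-enc (list τ) xs) (size-enc τ x) (size-enc (list τ) ys))
  where
  lemma : ∀ a b c → a + (1 + (b + c)) ≡ 1 + (b + a) + c
  lemma = solve-∀

size-reverse : ∀ τ (xs : List (El τ)) → size-enc (list τ) (reverse xs) ≡ size-enc (list τ) xs
size-reverse τ xs = suc-injective (trans (size-ʳ++ τ xs []) (+-comm _ 1))

size-ʳ++-≥ : ∀ τ (xs ys : List (El τ)) → size-enc (list τ) xs ≤ size-enc (list τ) (xs ʳ++ ys) ×
                                        size-enc (list τ) ys ≤ size-enc (list τ) (xs ʳ++ ys)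
size-ʳ++-≥ τ xs ys =
  s≤s⁻¹ (≤-trans (≤-reflexive (+-comm 1 _))
                 (≤-trans (+-monoʳ-≤ (size-enc (list τ) xs) (1≤size (enc (list τ) ys)))
                          (≤-reflexive (sym (size-ʳ++ τ xs ys))))) ,
  s≤s⁻¹ (≤-trans (+-monoˡ-≤ _ (1≤size (enc (list τ) xs))) (≤-reflexive (sym (size-ʳ++ τ xs ys))))

module _ {α : Ty} where

  private
    P-∷ : PolyTime (unit `× (α `× list α)) (list α) (λ (_ , x , xs) → x ∷ xs)
    P-∷ = polyTime ⇝-tail

  open Fold P-∷

  -- Moving an element from the list to the accumulator leaves the size of the state constant.
  reverse-bounded : ∀ M xs ys → size (state tt xs ys) ≤ M → Bounded M tt xs ys
  reverse-bounded M []       ys ≤M = ≤M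
  reverse-bounded M (x ∷ xs) ys ≤M = ≤M , reverse-bounded M xs (x ∷ ys)
    (≤-trans (≤-reflexive (lemma (size-enc α x) (size-enc (list α) xs) (size-enc (list α) ys))) ≤M)
    where
    lemma : ∀ a b c → 3 + (b + (1 + (a + c))) ≡ 4 + (a + b) + c
    lemma = solve-∀

  polyTime-reverse : PolyTime (list α) (list α) reverse
  polyTime-reverse = polyTime
    (⇝-pair ⇝-nil (⇝-pair ⇝-id ⇝-nil) ⇝⨾
     polyTime-iterate (λ _ → tt) id (λ _ → []) var (λ xs → reverse-bounded _ xs [] ≤-refl))

module _ {ε α β : Ty} {z : El ε → El β} {step : El (ε `× (α `× β)) → El β}
         (Z : PolyTime ε β z) (P : PolyTime (ε `× (α `× β)) β step) (q : Bound) where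

  private
    F : El ε → List (El α) → El β
    F e = foldr (λ a b → step (e , a , b)) (z e)

  open Fold P

  module _ (F-size : ∀ e xs → size-enc β (F e xs) ≤ ⟦ q ⟧ (size-enc (ε `× list α) (e , xs))) where

    -- Here `xs` is still to be processed and `ys` is done. The list `xs ʳ++ ys` is the same in
    -- every round, and its size bounds those of both `xs` and `ys`.
    state≤ : ∀ w e xs ys → size-enc (ε `× list α) (e , xs ʳ++ ys) ≤ w →
             size (state e xs (F e ys)) ≤ ⟦ con 1 ⊕ var ⊕ q ⟧ w
    state≤ w e xs ys ≤w = begin
      size (state e xs (F e ys))
        ≡⟨ lemma (size-enc ε e) _ _ ⟩
      1 + size-enc (ε `× list α) (e , xs) + size-enc β (F e ys)
        ≤⟨ +-mono-≤ (s≤s (≤-trans (s≤s (+-monoʳ-≤ (size-enc ε e) (proj₁ (size-ʳ++-≥ α xs ys)))) ≤w))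
                    (≤-trans (F-size e ys) (⟦⟧-mono q
                      (≤-trans (s≤s (+-monoʳ-≤ (size-enc ε e) (proj₂ (size-ʳ++-≥ α xs ys)))) ≤w))) ⟩
      ⟦ con 1 ⊕ var ⊕ q ⟧ w ∎
      where
      open ≤-Reasoning
      lemma : ∀ a b c → 1 + (a + (1 + (b + c))) ≡ 2 + (a + b) + c
      lemma = solve-∀

    foldr-bounded : ∀ w e xs ys → size-enc (ε `× list α) (e , xs ʳ++ ys) ≤ w →
                    Bounded (⟦ con 1 ⊕ var ⊕ q ⟧ w) e xs (F e ys)
    foldr-bounded w e []       ys ≤w = state≤ w e [] ys ≤w
    foldr-bounded w e (x ∷ xs) ys ≤w = state≤ w e (x ∷ xs) ys ≤w , foldr-bounded w e xs (x ∷ ys) ≤w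

    -- The loop folds from the left, so the list is reversed first. Every accumulator is then the
    -- right fold of a suffix of the list, so a polynomial size bound on the results of the fold
    -- controls the whole run.
    polyTime-foldr : PolyTime (ε `× list α) β (λ (e , xs) → F e xs)
    polyTime-foldr = polyTime (⇝-ext (λ _ → refl) (λ (e , xs) → cong (enc β) (iterate-reverse e xs))
      (⇝-pair ⇝-head (⇝-pair (⇝-tail ⇝⨾ ⇝-∘ (computes polyTime-reverse) proj₂)
                              (⇝-head ⇝⨾ ⇝-∘ (computes Z) proj₁)) ⇝⨾
       polyTime-iterate proj₁ (λ (e , xs) → reverse xs) (λ (e , xs) → z e) (con 1 ⊕ var ⊕ q)
         (λ (e , xs) → foldr-bounded _ e (reverse xs) [] (input≤ e xs))))
      where
      iterate-reverse : ∀ e xs → iterate e (reverse xs) (z e) ≡ F e xs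
      iterate-reverse e xs = trans (sym (reverse-foldr (λ a b → step (e , a , b)) (z e) (reverse xs)))
                                   (cong (F e) (reverse-involutive xs))
      input≤ : ∀ e xs → size-enc (ε `× list α) (e , reverse (reverse xs)) ≤ size (state e (reverse xs) (z e))
      input≤ e xs = s≤s (+-monoʳ-≤ (size-enc ε e) (begin
        size-enc (list α) (reverse (reverse xs))                   ≡⟨ size-reverse α (reverse xs) ⟩
        size-enc (list α) (reverse xs)                             ≤⟨ m≤m+n _ _ ⟩
        size-enc (list α) (reverse xs) + size-enc β (z e)          ≤⟨ n≤1+n _ ⟩
        size-enc (list α `× β) (reverse xs , z e)                  ∎))
        where open ≤-Reasoning

-- Combinators for polynomial-time functions

private
  variable
    Γ α β σ τ : Ty

⇝-isZero : enc nat ⇝ λ n → ⌜ n ≡ᵇ 0 ⌝𝔹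
⇝-isZero = record
  { prog = if skip then const-nil else pair const-nil const-nil
  ; time = var ⊕ var ⊕ con 3 ⊗ var
  ; run  = λ where
      zero    → _ , ≤-refl , ⇓else ⇓skip (⇓pair ⇓nil ⇓nil)
      (suc n) → _ , +-monoʳ-≤ (size-enc nat (suc n) + size-enc nat (suc n)) (m≤m+n _ _) , ⇓then ⇓skip ⇓nil
  }

pt-ext : ∀ {F G : El Γ → El τ} → (∀ γ → F γ ≡ G γ) → PolyTime Γ τ F → PolyTime Γ τ G
pt-ext {τ = τ} eq (polyTime f) = polyTime (⇝-ext (λ _ → refl) (λ γ → cong (enc τ) (eq γ)) f)

pt-∘ : ∀ {F : El Γ → El σ} {G : El σ → El τ} → PolyTime σ τ G → PolyTime Γ σ F → PolyTime Γ τ (G ∘ F)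
pt-∘ {F = F} (polyTime g) (polyTime f) = polyTime (f ⇝⨾ ⇝-∘ g F)

pt-id : PolyTime Γ Γ id
pt-id = polyTime ⇝-id

pt-fst : ∀ {F : El Γ → El (σ `× τ)} → PolyTime Γ (σ `× τ) F → PolyTime Γ σ (proj₁ ∘ F)
pt-fst (polyTime f) = polyTime (f ⇝⨾ ⇝-head)

pt-snd : ∀ {F : El Γ → El (σ `× τ)} → PolyTime Γ (σ `× τ) F → PolyTime Γ τ (proj₂ ∘ F)
pt-snd (polyTime f) = polyTime (f ⇝⨾ ⇝-tail)

pt-pair : ∀ {F : El Γ → El σ} {G : El Γ → El τ} → PolyTime Γ σ F → PolyTime Γ τ G →
          PolyTime Γ (σ `× τ) (λ γ → F γ , G γ)
pt-pair (polyTime f) (polyTime g) = polyTime (⇝-pair f g)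

pt-false : PolyTime Γ bool (λ _ → false)
pt-false = polyTime ⇝-nil

pt-true : PolyTime Γ bool (λ _ → true)
pt-true = polyTime (⇝-pair ⇝-nil ⇝-nil)

pt-zero : PolyTime Γ nat (λ _ → 0)
pt-zero = polyTime ⇝-nil

pt-suc : ∀ {F : El Γ → ℕ} → PolyTime Γ nat F → PolyTime Γ nat (suc ∘ F)
pt-suc (polyTime f) = polyTime (⇝-pair ⇝-nil f)

pt-[] : PolyTime Γ (list τ) (λ _ → [])
pt-[] = polyTime ⇝-nil

pt-∷ : ∀ {F : El Γ → El τ} {G : El Γ → List (El τ)} → PolyTime Γ τ F → PolyTime Γ (list τ) G →
       PolyTime Γ (list τ) (λ γ → F γ ∷ G γ)
pt-∷ (polyTime f) (polyTime g) = polyTime (⇝-pair f g)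

pt-if : ∀ {b : El Γ → Bool} {F G : El Γ → El τ} → PolyTime Γ bool b → PolyTime Γ τ F → PolyTime Γ τ G →
        PolyTime Γ τ (λ γ → Bool.if b γ then F γ else G γ)
pt-if {τ = τ} {b = b} (polyTime c) (polyTime f) (polyTime g) =
  polyTime (⇝-ext (λ _ → refl) (λ γ → sym (if-float (enc τ) (b γ))) (⇝-if c f g))

pt-foldr : ∀ {xs : El Γ → List (El α)} {z : El Γ → El β} {step : El (Γ `× (α `× β)) → El β} →
  PolyTime Γ (list α) xs → PolyTime Γ β z → PolyTime (Γ `× (α `× β)) β step → (q : Bound) →
  (∀ γ as → size-enc β (foldr (λ a b → step (γ , a , b)) (z γ) as) ≤ ⟦ q ⟧ (size-enc (Γ `× list α) (γ , as))) →
  PolyTime Γ β (λ γ → foldr (λ a b → step (γ , a , b)) (z γ) (xs γ))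
pt-foldr P Z S q bound = pt-∘ (polyTime-foldr Z S q bound) (pt-pair pt-id P)

size-proj₂ : ∀ σ τ (x : El σ) (y : El τ) → size-enc τ y ≤ size-enc (σ `× τ) (x , y)
size-proj₂ σ τ x y = ≤-trans (m≤n+m _ (size-enc σ x)) (n≤1+n _)

size-proj₁ : ∀ σ τ (x : El σ) (y : El τ) → size-enc σ x ≤ size-enc (σ `× τ) (x , y)
size-proj₁ σ τ x y = ≤-trans (m≤m+n _ (size-enc τ y)) (n≤1+n _)

output-size : ∀ {F : El Γ → El τ} (P : PolyTime Γ τ F) γ →
  size-enc τ (F γ) ≤ ⟦ time (computes P) ⟧ (size-enc Γ γ)
output-size P γ = let _ , t≤ , d = run (computes P) γ in ≤-trans (size≤time d) t≤

pt-length : ∀ {xs : El Γ → List (El α)} → PolyTime Γ (list α) xs → PolyTime Γ nat (length ∘ xs)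
pt-length {Γ} {α} {xs = xs} P = pt-ext (length-foldr ∘ xs)
  (pt-foldr P pt-zero (pt-suc (pt-snd (pt-snd pt-id))) var
    (λ γ as → ≤-trans (size-length as) (size-proj₂ Γ (list α) γ as)))
  where
  length-foldr : ∀ (as : List (El α)) → foldr (λ _ → suc) 0 as ≡ length as
  length-foldr []       = refl
  length-foldr (a ∷ as) = cong suc (length-foldr as)
  size-length : ∀ as → size-enc nat (foldr (λ _ → suc) 0 as) ≤ size-enc (list α) as
  size-length []       = ≤-refl
  size-length (a ∷ as) = s≤s (+-mono-≤ (1≤size (enc α a)) (size-length as))

size-++ : ∀ τ (xs ys : List (El τ)) → size-enc (list τ) (xs ++ ys) ≤ size-enc (list τ) xs + size-enc (list τ) ys
size-++ τ []       ys = n≤1+n _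
size-++ τ (x ∷ xs) ys = s≤s (≤-trans (+-monoʳ-≤ (size-enc τ x) (size-++ τ xs ys))
                                       (≤-reflexive (sym (+-assoc (size-enc τ x) _ _))))

pt-++ : ∀ {xs ys : El Γ → List (El α)} → PolyTime Γ (list α) xs → PolyTime Γ (list α) ys →
        PolyTime Γ (list α) (λ γ → xs γ ++ ys γ)
pt-++ {Γ} {α} P Q = pt-∘ append (pt-pair P Q)
  where
  foldr-∷ : ∀ (xs ys : List (El α)) → foldr _∷_ ys xs ≡ xs ++ ys
  foldr-∷ []       ys = refl
  foldr-∷ (x ∷ xs) ys = cong (x ∷_) (foldr-∷ xs ys)
  append : PolyTime (list α `× list α) (list α) (λ (xs , ys) → xs ++ ys)
  append = pt-ext (λ (xs , ys) → foldr-∷ xs ys)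
    (pt-foldr (pt-fst pt-id) (pt-snd pt-id) (pt-∷ (pt-fst (pt-snd pt-id)) (pt-snd (pt-snd pt-id))) (con 2 ⊗ var)
      append-size)
    where
    append-size : ∀ ((xs , ys) : List (El α) × List (El α)) as →
      size-enc (list α) (foldr _∷_ ys as) ≤ 2 * size-enc ((list α `× list α) `× list α) ((xs , ys) , as)
    append-size (xs , ys) as = begin
      size-enc (list α) (foldr _∷_ ys as)               ≡⟨ cong (size-enc (list α)) (foldr-∷ as ys) ⟩
      size-enc (list α) (as ++ ys)                      ≤⟨ size-++ α as ys ⟩
      size-enc (list α) as + size-enc (list α) ys
        ≤⟨ +-mono-≤ (size-proj₂ (list α `× list α) (list α) (xs , ys) as)
                    (≤-trans (≤-trans (size-proj₂ (list α) (list α) xs ys)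
                                      (size-proj₁ (list α `× list α) (list α) (xs , ys) as))
                             (≤-reflexive (sym (+-identityʳ _)))) ⟩
      2 * size-enc ((list α `× list α) `× list α) ((xs , ys) , as) ∎
      where open ≤-Reasoning

pt-concatMap : ∀ {xs : El Γ → List (El α)} {f : El (Γ `× α) → List (El β)} →
  PolyTime Γ (list α) xs → PolyTime (Γ `× α) (list β) f →
  PolyTime Γ (list β) (λ γ → concatMap (λ a → f (γ , a)) (xs γ))
pt-concatMap {Γ} {α} {β} {xs} {f} P Q = pt-ext (λ γ → foldr-concatMap γ (xs γ))
  (pt-foldr P pt-[] (pt-++ (pt-∘ Q (pt-pair (pt-fst pt-id) (pt-fst (pt-snd pt-id)))) (pt-snd (pt-snd pt-id)))
    (var ⊗ (con 1 ⊕ q))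
    (λ γ as → ≤-trans (size-concatMap _ γ as ≤-refl)
      (*-monoˡ-≤ (suc (⟦ q ⟧ (size-enc (Γ `× list α) (γ , as)))) (size-proj₂ Γ (list α) γ as))))
  where
  q : Bound
  q = time (computes Q)
  F : El Γ → List (El α) → List (El β)
  F γ = foldr (λ a b → f (γ , a) ++ b) []
  foldr-concatMap : ∀ γ as → F γ as ≡ concatMap (λ a → f (γ , a)) as
  foldr-concatMap γ []       = refl
  foldr-concatMap γ (a ∷ as) = cong (f (γ , a) ++_) (foldr-concatMap γ as)
  -- The image of an element is no larger than the time taken to compute it, and the size of the
  -- list bounds the number of elements. The successor leaves room for the final `nil`.
  size-concatMap : ∀ w γ as → size-enc (Γ `× list α) (γ , as) ≤ w →
    size-enc (list β) (F γ as) ≤ size-enc (list α) as * suc (⟦ q ⟧ w)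
  size-concatMap w γ []       ≤w = s≤s z≤n
  size-concatMap w γ (a ∷ as) ≤w = begin
    size-enc (list β) (f (γ , a) ++ F γ as)  ≤⟨ size-++ β (f (γ , a)) (F γ as) ⟩
    size-enc (list β) (f (γ , a)) + size-enc (list β) (F γ as)
      ≤⟨ +-mono-≤ f≤ (size-concatMap w γ as
           (≤-trans (s≤s (+-monoʳ-≤ (size-enc Γ γ) (size-proj₂ α (list α) a as))) ≤w)) ⟩
    K + size-enc (list α) as * K             ≤⟨ +-monoʳ-≤ K (*-monoˡ-≤ K (m≤n+m _ (size-enc α a))) ⟩
    size-enc (list α) (a ∷ as) * K           ∎
    where
    open ≤-Reasoning
    K = suc (⟦ q ⟧ w)
    f≤ : size-enc (list β) (f (γ , a)) ≤ K
    f≤ = ≤-trans (output-size Q (γ , a)) (≤-trans (⟦⟧-mono q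
           (≤-trans (s≤s (+-monoʳ-≤ (size-enc Γ γ) (size-proj₁ α (list α) a as))) ≤w)) (n≤1+n _))

pt-map : ∀ {xs : El Γ → List (El α)} {f : El (Γ `× α) → El β} →
  PolyTime Γ (list α) xs → PolyTime (Γ `× α) β f → PolyTime Γ (list β) (λ γ → map (λ a → f (γ , a)) (xs γ))
pt-map {Γ} {α} {β} {xs} {f} P Q = pt-ext (λ γ → concatMap-[-] γ (xs γ)) (pt-concatMap P (pt-∷ Q pt-[]))
  where
  concatMap-[-] : ∀ γ as → concatMap (λ a → [ f (γ , a) ]) as ≡ map (λ a → f (γ , a)) as
  concatMap-[-] γ []       = refl
  concatMap-[-] γ (a ∷ as) = cong (f (γ , a) ∷_) (concatMap-[-] γ as)

pt-cartesianProductWith : ∀ {xs : El Γ → List (El α)} {ys : El Γ → List (El β)} {f : El α → El β → El τ} →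
  PolyTime Γ (list α) xs → PolyTime Γ (list β) ys → PolyTime (α `× β) τ (λ (a , b) → f a b) →
  PolyTime Γ (list τ) (λ γ → cartesianProductWith f (xs γ) (ys γ))
pt-cartesianProductWith {Γ} {α} {β} {τ} {xs} {ys} {f} P Q R = pt-ext (λ γ → concatMap-map (xs γ) (ys γ))
  (pt-concatMap P (pt-map (pt-∘ Q (pt-fst pt-id)) (pt-∘ R (pt-pair (pt-snd (pt-fst pt-id)) (pt-snd pt-id)))))
  where
  concatMap-map : ∀ as bs → concatMap (λ a → map (f a) bs) as ≡ cartesianProductWith f as bs
  concatMap-map []       bs = refl
  concatMap-map (a ∷ as) bs = cong (map (f a) bs ++_) (concatMap-map as bs)

-- A unary number and a list of units are the same tree. This turns loops over lists into loops that
-- count.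
pt-replicate : ∀ {F : El Γ → ℕ} → PolyTime Γ nat F → PolyTime Γ (list unit) (λ γ → replicate (F γ) tt)
pt-replicate {F = F} (polyTime f) = polyTime (⇝-ext (λ _ → refl) (unary ∘ F) f)
  where
  unary : ∀ n → enc nat n ≡ enc (list unit) (replicate n tt)
  unary zero    = refl
  unary (suc n) = cong (cons nil) (unary n)

pt-downFrom : ∀ {F : El Γ → ℕ} → PolyTime Γ nat F → PolyTime Γ (list nat) (downFrom ∘ F)
pt-downFrom {Γ} {F = F} P = pt-ext
  (λ γ → trans (G-downFrom (replicate (F γ) tt)) (cong downFrom (length-replicate (F γ))))
  -- The length of the list built so far is the next number to be put in front.
  (pt-foldr (pt-replicate P) pt-[] (pt-∷ (pt-length (pt-snd (pt-snd pt-id))) (pt-snd (pt-snd pt-id)))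
    (var ⊗ var)
    (λ γ us → ≤-trans (size-G us) (*-mono-≤ (size-proj₂ Γ (list unit) γ us) (size-proj₂ Γ (list unit) γ us))))
  where
  G : List ⊤ → List ℕ
  G = foldr (λ _ ns → length ns ∷ ns) []
  length-G : ∀ us → length (G us) ≡ length us
  length-G []       = refl
  length-G (_ ∷ us) = cong suc (length-G us)
  G-downFrom : ∀ us → G us ≡ downFrom (length us)
  G-downFrom []       = refl
  G-downFrom (_ ∷ us) = cong₂ _∷_ (length-G us) (G-downFrom us)
  size-unary : ∀ us → size-enc nat (length us) ≡ size-enc (list unit) us
  size-unary []       = refl
  size-unary (_ ∷ us) = cong (2 +_) (size-unary us)
  size-G : ∀ us → size-enc (list nat) (G us) ≤ size-enc (list unit) us * size-enc (list unit) us
  size-G []       = ≤-refl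
  size-G (_ ∷ us) = begin
    suc (size-enc nat (length (G us)) + size-enc (list nat) (G us))
      ≤⟨ s≤s (+-mono-≤ (≤-reflexive (trans (cong (size-enc nat) (length-G us)) (size-unary us))) (size-G us)) ⟩
    suc (s + s * s)                                                  ≤⟨ m≤m+n _ (3 + 3 * s) ⟩
    suc (s + s * s) + (3 + 3 * s)                                    ≡⟨ lemma s ⟩
    (2 + s) * (2 + s)                                                ∎
    where
    open ≤-Reasoning
    s = size-enc (list unit) us
    lemma : ∀ s → 1 + (s + s * s) + (3 + 3 * s) ≡ (2 + s) * (2 + s)
    lemma = solve-∀

pt-∸ : ∀ {F G : El Γ → ℕ} → PolyTime Γ nat F → PolyTime Γ nat G → PolyTime Γ nat (λ γ → F γ ∸ G γ)
pt-∸ P Q = pt-∘ monus (pt-pair P Q)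
  where
  foldr-pred : ∀ m (us : List ⊤) → foldr (λ _ → pred) m us ≡ m ∸ length us
  foldr-pred m []       = refl
  foldr-pred m (_ ∷ us) = trans (cong pred (foldr-pred m us)) (pred[m∸n]≡m∸[1+n] m (length us))
  size-mono : ∀ {m n} → m ≤ n → size-enc nat m ≤ size-enc nat n
  size-mono {n = n} z≤n = 1≤size (enc nat n)
  size-mono (s≤s m≤n)   = s≤s (s≤s (size-mono m≤n))
  pt-pred : ∀ {Γ} {F : El Γ → ℕ} → PolyTime Γ nat F → PolyTime Γ nat (pred ∘ F)
  pt-pred {F = F} (polyTime f) = polyTime (⇝-ext (λ _ → refl) (tail-pred ∘ F) (f ⇝⨾ ⇝-tail))
    where
    tail-pred : ∀ n → tail (enc nat n) ≡ enc nat (pred n)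
    tail-pred zero    = refl
    tail-pred (suc n) = refl
  monus : PolyTime (nat `× nat) nat (λ (m , n) → m ∸ n)
  monus = pt-ext (λ (m , n) → trans (foldr-pred m (replicate n tt)) (cong (m ∸_) (length-replicate n)))
    (pt-foldr (pt-replicate (pt-snd pt-id)) (pt-fst pt-id) (pt-pred (pt-snd (pt-snd pt-id))) var
      (λ (m , n) us → ≤-trans (size-mono (≤-trans (≤-reflexive (foldr-pred m us)) (m∸n≤m m (length us))))
        (≤-trans (size-proj₁ nat nat m n) (size-proj₁ (nat `× nat) (list unit) (m , n) us))))

-- Predicates decidable in polynomial time

record PolyDec (Γ : Ty) {P : El Γ → Set} (P? : ∀ γ → Dec (P γ)) : Set where
  constructor polyDec
  field
    decides : PolyTime Γ bool (λ γ → does (P? γ))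

open PolyDec

pd-⇔ : {P Q : El Γ → Set} {P? : ∀ γ → Dec (P γ)} {Q? : ∀ γ → Dec (Q γ)} →
       (∀ {γ} → P γ → Q γ) → (∀ {γ} → Q γ → P γ) → PolyDec Γ P? → PolyDec Γ Q?
pd-⇔ {P? = P?} {Q?} to from (polyDec p) = polyDec (pt-ext (λ γ → does-⇔ (mk⇔ to from) (P? γ) (Q? γ)) p)

pd-∘ : {P : El σ → Set} {P? : ∀ x → Dec (P x)} {F : El Γ → El σ} →
       PolyDec σ P? → PolyTime Γ σ F → PolyDec Γ (P? ∘ F)
pd-∘ (polyDec p) f = polyDec (pt-∘ p f)

pd-× : {P Q : El Γ → Set} {P? : ∀ γ → Dec (P γ)} {Q? : ∀ γ → Dec (Q γ)} → PolyDec Γ P? → PolyDec Γ Q? →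
       PolyDec Γ (λ γ → P? γ ×-dec Q? γ)
pd-× {P? = P?} (polyDec p) (polyDec q) = polyDec (pt-ext (λ γ → if-∧ (does (P? γ))) (pt-if p q pt-false))
  where
  if-∧ : ∀ b {c} → (Bool.if b then c else false) ≡ b ∧ c
  if-∧ false = refl
  if-∧ true  = refl

pd-⊎ : {P Q : El Γ → Set} {P? : ∀ γ → Dec (P γ)} {Q? : ∀ γ → Dec (Q γ)} → PolyDec Γ P? → PolyDec Γ Q? →
       PolyDec Γ (λ γ → P? γ ⊎-dec Q? γ)
pd-⊎ {P? = P?} (polyDec p) (polyDec q) = polyDec (pt-ext (λ γ → if-∨ (does (P? γ))) (pt-if p pt-true q))
  where
  if-∨ : ∀ b {c} → (Bool.if b then true else c) ≡ b ∨ c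
  if-∨ false = refl
  if-∨ true  = refl

pd-¬ : {P : El Γ → Set} {P? : ∀ γ → Dec (P γ)} → PolyDec Γ P? → PolyDec Γ (λ γ → ¬? (P? γ))
pd-¬ {P? = P?} (polyDec p) = polyDec (pt-ext (λ γ → if-not (does (P? γ))) (pt-if p pt-false pt-true))
  where
  if-not : ∀ b → (Bool.if b then false else true) ≡ not b
  if-not false = refl
  if-not true  = refl

size-bool : ∀ b → size-enc bool b ≤ 3
size-bool false = s≤s z≤n
size-bool true  = ≤-refl

pd-any : {P : El (Γ `× α) → Set} {P? : ∀ x → Dec (P x)} {xs : El Γ → List (El α)} →
         PolyTime Γ (list α) xs → PolyDec (Γ `× α) P? →
         PolyDec Γ (λ γ → any? (λ a → P? (γ , a)) (xs γ))
pd-any {Γ} {α} {P? = P?} {xs} as (polyDec p) = polyDec (pt-ext (λ γ → foldr-any γ (xs γ))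
  (pt-foldr as pt-false
    (pt-if (pt-∘ p (pt-pair (pt-fst pt-id) (pt-fst (pt-snd pt-id)))) pt-true (pt-snd (pt-snd pt-id)))
    (con 3) (λ γ as → size-bool (foldr (λ a b → Bool.if does (P? (γ , a)) then true else b) false as))))
  where
  foldr-any : ∀ γ as → foldr (λ a b → Bool.if does (P? (γ , a)) then true else b) false as ≡
                       does (any? (λ a → P? (γ , a)) as)
  foldr-any γ []       = refl
  foldr-any γ (a ∷ as) with does (P? (γ , a))
  ... | true  = refl
  ... | false = foldr-any γ as

pd-all : {P : El (Γ `× α) → Set} {P? : ∀ x → Dec (P x)} {xs : El Γ → List (El α)} →
         PolyTime Γ (list α) xs → PolyDec (Γ `× α) P? →
         PolyDec Γ (λ γ → all? (λ a → P? (γ , a)) (xs γ))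
pd-all {Γ} {α} {P? = P?} {xs} as (polyDec p) = polyDec (pt-ext (λ γ → foldr-all γ (xs γ))
  (pt-foldr as pt-true
    (pt-if (pt-∘ p (pt-pair (pt-fst pt-id) (pt-fst (pt-snd pt-id)))) (pt-snd (pt-snd pt-id)) pt-false)
    (con 3) (λ γ as → size-bool (foldr (λ a b → Bool.if does (P? (γ , a)) then b else false) true as))))
  where
  foldr-all : ∀ γ as → foldr (λ a b → Bool.if does (P? (γ , a)) then b else false) true as ≡
                       does (all? (λ a → P? (γ , a)) as)
  foldr-all γ []       = refl
  foldr-all γ (a ∷ as) with does (P? (γ , a))
  ... | true  = foldr-all γ as
  ... | false = refl

pt-filter : {P : El (Γ `× α) → Set} {P? : ∀ x → Dec (P x)} {xs : El Γ → List (El α)} →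
            PolyTime Γ (list α) xs → PolyDec (Γ `× α) P? →
            PolyTime Γ (list α) (λ γ → filter (λ a → P? (γ , a)) (xs γ))
pt-filter {Γ} {α} {P? = P?} {xs} as (polyDec p) = pt-ext (λ γ → concatMap-if γ (xs γ))
  (pt-concatMap as (pt-if p (pt-∷ (pt-snd pt-id) pt-[]) pt-[]))
  where
  concatMap-if : ∀ γ as → concatMap (λ a → Bool.if does (P? (γ , a)) then [ a ] else []) as ≡
                          filter (λ a → P? (γ , a)) as
  concatMap-if γ []       = refl
  concatMap-if γ (a ∷ as) with does (P? (γ , a))
  ... | true  = cong (a ∷_) (concatMap-if γ as)
  ... | false = concatMap-if γ as

pd-≤ : ∀ {F G : El Γ → ℕ} → PolyTime Γ nat F → PolyTime Γ nat G → PolyDec Γ (λ γ → F γ ≤? G γ)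
pd-≤ {F = F} {G} f g = pd-⇔ {P? = λ γ → F γ ∸ G γ ≟ 0} (λ {γ} → m∸n≡0⇒m≤n {F γ}) (λ {γ} → m≤n⇒m∸n≡0 {F γ})
  (polyDec (pt-∘ (polyTime ⇝-isZero) (pt-∸ f g)))

pd-≟ : ∀ {F G : El Γ → ℕ} → PolyTime Γ nat F → PolyTime Γ nat G → PolyDec Γ (λ γ → F γ ≟ G γ)
pd-≟ f g = pd-⇔ (λ (m≤n , n≤m) → ≤-antisym m≤n n≤m) (λ eq → ≤-reflexive eq , ≤-reflexive (sym eq))
  (pd-× (pd-≤ f g) (pd-≤ g f))

pd-T : ∀ {b : El Γ → Bool} → PolyTime Γ bool b → PolyDec Γ (λ γ → T? (b γ))
pd-T p = polyDec p

-- Tuples of fixed length and powers with fixed exponent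

tuples : ∀ {A : Set} → ℕ → List A → List (List A)
tuples zero    xs = [ [] ]
tuples (suc n) xs = cartesianProductWith _∷_ xs (tuples n xs)

length-cartesianProductWith : ∀ {A B C : Set} (f : A → B → C) xs ys →
  length (cartesianProductWith f xs ys) ≡ length xs * length ys
length-cartesianProductWith f []       ys = refl
length-cartesianProductWith f (x ∷ xs) ys = trans (length-++ (map (f x) ys))
  (cong₂ _+_ (length-map (f x) ys) (length-cartesianProductWith f xs ys))

length-tuples : ∀ {A : Set} n (xs : List A) → length (tuples n xs) ≡ length xs ^ n
length-tuples zero    xs = refl
length-tuples (suc n) xs =
  trans (length-cartesianProductWith _∷_ xs (tuples n xs)) (cong (length xs *_) (length-tuples n xs))

-- The length n is not part of the input: the recursion builds a different program for each n, whose
-- degree may depend on n.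
pt-tuples : ∀ n {xs : El Γ → List (El α)} →
  PolyTime Γ (list α) xs → PolyTime Γ (list (list α)) (λ γ → tuples n (xs γ))
pt-tuples zero    P = pt-∷ pt-[] pt-[]
pt-tuples (suc n) P = pt-cartesianProductWith P (pt-tuples n P) (pt-∷ (pt-fst pt-id) (pt-snd pt-id))

-- The power is computed by counting tuples.
pt-^ : ∀ n {F : El Γ → ℕ} → PolyTime Γ nat F → PolyTime Γ nat (λ γ → F γ ^ n)
pt-^ n {F} P = pt-ext (λ γ → trans (length-tuples n (downFrom (F γ))) (cong (_^ n) (length-downFrom (F γ))))
  (pt-length (pt-tuples n (pt-downFrom P)))

-- Subsets as sequences of gaps

-- gap a o S i is the i-th block of S, where S is a set of variables starting at
-- number o and the current block has started at a ≤ o.  For i > ∣ S ∣ the value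
-- is junk: the last block again.
gap : ∀ {m} → ℕ → ℕ → Subset m → ℕ → ℕ × ℕ
gap a o []            i       = a , o
gap a o (outside ∷ S) i       = gap a (suc o) S i
gap a o (inside  ∷ S) zero    = a , o
gap a o (inside  ∷ S) (suc i) = gap (suc o) (suc o) S i

gap-start : ∀ {m a o} → a ≤ o → (S : Subset m) → ∀ i → a ≤ proj₁ (gap a o S i)
gap-start a≤o []            i       = ≤-refl
gap-start a≤o (outside ∷ S) i       = gap-start (m≤n⇒m≤1+n a≤o) S i
gap-start a≤o (inside  ∷ S) zero    = ≤-refl
gap-start a≤o (inside  ∷ S) (suc i) = ≤-trans (m≤n⇒m≤1+n a≤o) (gap-start ≤-refl S i)

gap-ordered : ∀ {m a o} → a ≤ o → (S : Subset m) → ∀ i → proj₁ (gap a o S i) ≤ proj₂ (gap a o S i)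
gap-ordered a≤o []            i       = a≤o
gap-ordered a≤o (outside ∷ S) i       = gap-ordered (m≤n⇒m≤1+n a≤o) S i
gap-ordered a≤o (inside  ∷ S) zero    = a≤o
gap-ordered a≤o (inside  ∷ S) (suc i) = gap-ordered ≤-refl S i

gap-end-≥ : ∀ {m} a o (S : Subset m) i → o ≤ proj₂ (gap a o S i)
gap-end-≥ a o []            i       = ≤-refl
gap-end-≥ a o (outside ∷ S) i       = <⇒≤ (gap-end-≥ a (suc o) S i)
gap-end-≥ a o (inside  ∷ S) zero    = ≤-refl
gap-end-≥ a o (inside  ∷ S) (suc i) = <⇒≤ (gap-end-≥ (suc o) (suc o) S i)

gap-end-≤ : ∀ {m} a o (S : Subset m) i → proj₂ (gap a o S i) ≤ o + m
gap-end-≤         a o []            i       = m≤m+n o 0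
gap-end-≤ {suc m} a o (outside ∷ S) i       = ≤-trans (gap-end-≤ a (suc o) S i) (≤-reflexive (sym (+-suc o m)))
gap-end-≤ {suc m} a o (inside  ∷ S) zero    = m≤m+n o (suc m)
gap-end-≤ {suc m} a o (inside  ∷ S) (suc i) = ≤-trans (gap-end-≤ (suc o) (suc o) S i)
                                                      (≤-reflexive (sym (+-suc o m)))

gap-first : ∀ {m} a o (S : Subset m) → proj₁ (gap a o S 0) ≡ a
gap-first a o []            = refl
gap-first a o (outside ∷ S) = gap-first a (suc o) S
gap-first a o (inside  ∷ S) = refl

gap-last : ∀ {m} a o (S : Subset m) → proj₂ (gap a o S ∣ S ∣) ≡ o + m
gap-last         a o []            = sym (+-identityʳ o)
gap-last {suc m} a o (outside ∷ S) = trans (gap-last a (suc o) S) (sym (+-suc o m))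
gap-last {suc m} a o (inside  ∷ S) = trans (gap-last (suc o) (suc o) S) (sym (+-suc o m))

gap-link : ∀ {m} a o (S : Subset m) i → i < ∣ S ∣ → proj₁ (gap a o S (suc i)) ≡ suc (proj₂ (gap a o S i))
gap-link a o (outside ∷ S) i       i<       = gap-link a (suc o) S i i<
gap-link a o (inside  ∷ S) zero    i<       = gap-first (suc o) (suc o) S
gap-link a o (inside  ∷ S) (suc i) (s≤s i<) = gap-link (suc o) (suc o) S i i<

-- After each true variable the next block starts one position later, so no true variable lies in
-- the interior of a block. Together with `gap-boundary` this shows that a literal satisfied by S is
-- false at no block.
gap-interior : ∀ {m} a o (S : Subset m) i x →
  proj₁ (gap a o S i) ≤ o + toℕ x → o + toℕ x < proj₂ (gap a o S i) → x ∉ S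
gap-interior a o (outside ∷ S) i (suc x) ≤x x< (Vec.there x∈S) =
  gap-interior a (suc o) S i x
    (≤-trans ≤x (≤-reflexive (+-suc o (toℕ x)))) (≤-<-trans (≤-reflexive (sym (+-suc o (toℕ x)))) x<) x∈S
gap-interior a o (inside ∷ S) zero x ≤x x< x∈S = <⇒≱ x< (m≤m+n o (toℕ x))
gap-interior a o (inside ∷ S) (suc i) zero ≤x x< x∈S =
  <⇒≱ (gap-start ≤-refl S i) (≤-trans ≤x (≤-reflexive (+-identityʳ o)))
gap-interior a o (inside ∷ S) (suc i) (suc x) ≤x x< (Vec.there x∈S) =
  gap-interior (suc o) (suc o) S i x
    (≤-trans ≤x (≤-reflexive (+-suc o (toℕ x)))) (≤-<-trans (≤-reflexive (sym (+-suc o (toℕ x)))) x<) x∈S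

-- A block is closed either by a true variable or by the end of the range. In the latter case its
-- end is the number of no variable.
gap-boundary : ∀ {m} a o (S : Subset m) i x → o + toℕ x ≡ proj₂ (gap a o S i) → x ∈ S
gap-boundary a o (outside ∷ S) i zero x≡ =
  contradiction (subst (suc o ≤_) (sym (trans (sym (+-identityʳ o)) x≡)) (gap-end-≥ a (suc o) S i)) 1+n≰n
gap-boundary a o (outside ∷ S) i (suc x) x≡ =
  Vec.there (gap-boundary a (suc o) S i x (trans (sym (+-suc o (toℕ x))) x≡))
gap-boundary a o (inside ∷ S) i zero x≡ = Vec.here
gap-boundary a o (inside ∷ S) zero (suc x) x≡ = contradiction x≡ (m+1+n≢m o)
gap-boundary a o (inside ∷ S) (suc i) (suc x) x≡ =
  Vec.there (gap-boundary (suc o) (suc o) S i x (trans (sym (+-suc o (toℕ x))) x≡))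

-- The conditions at the two outer ends are stated separately, so that dropping the first block
-- leaves a gap sequence again.
record IsGapSequence (k : ℕ) (f : ℕ → ℕ × ℕ) : Set where
  field
    ordered : ∀ i → i ≤ k → proj₁ (f i) ≤ proj₂ (f i)
    linked  : ∀ i → i < k → proj₁ (f (suc i)) ≡ suc (proj₂ (f i))

open IsGapSequence

IsGapSequence-suc : ∀ {k f} → IsGapSequence (suc k) f → IsGapSequence k (f ∘ suc)
IsGapSequence-suc G = record { ordered = λ i → ordered G (suc i) ∘ s≤s ; linked = λ i → linked G (suc i) ∘ s≤s }

-- A block starts right after the end of its predecessor, so the ends grow by at least one per step.
first-end≤last-end : ∀ k {f} → IsGapSequence k f → k + proj₂ (f 0) ≤ proj₂ (f k)
first-end≤last-end zero    G = ≤-refl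
first-end≤last-end (suc k) {f} G = begin
  suc k + proj₂ (f 0)    ≡⟨ +-suc k (proj₂ (f 0)) ⟨
  k + suc (proj₂ (f 0))  ≡⟨ cong (k +_) (linked G 0 (s≤s z≤n)) ⟨
  k + proj₁ (f 1)        ≤⟨ +-monoʳ-≤ k (ordered G 1 (s≤s z≤n)) ⟩
  k + proj₂ (f 1)        ≤⟨ first-end≤last-end k (IsGapSequence-suc G) ⟩
  proj₂ (f (suc k))      ∎
  where open ≤-Reasoning

second-start : ∀ {k f o} → IsGapSequence (suc k) f → o ≡ proj₂ (f 0) → proj₁ (f 1) ≡ suc o
second-start G o≡b = trans (linked G 0 (s≤s z≤n)) (cong suc (sym o≡b))

-- This inverts `gap` by scanning the variables: `o` is the next one and `f 0` the current block. A
-- variable before the end of that block is left out; the one at its end is put in, and the scan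
-- passes to the next block. The witnesses returned show that a literal not satisfied by S is false
-- at some block.
gaps⇒subset : ∀ m k f o → IsGapSequence k f → proj₁ (f 0) ≤ o → o ≤ proj₂ (f 0) → proj₂ (f k) ≡ o + m →
  ∃[ S ] ∣ S ∣ ≡ k ×
  (∀ (x : Fin m) → x ∉ S → ∃[ i ] i ≤ k × proj₁ (f i) ≤ o + toℕ x × o + toℕ x < proj₂ (f i)) ×
  (∀ (x : Fin m) → x ∈ S → ∃[ i ] i ≤ k × o + toℕ x ≡ proj₂ (f i))
gaps⇒subset zero zero f o G a≤o o≤b last = [] , refl , (λ ()) , (λ ())
-- No variable remains, but the ends of at least two blocks increase strictly from `o` or more,
-- while the last must be `o`.
gaps⇒subset zero (suc k) f o G a≤o o≤b last = contradiction (begin-strict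
  o                    ≤⟨ o≤b ⟩
  proj₂ (f 0)          <⟨ m≤n+m (suc (proj₂ (f 0))) k ⟩
  k + suc (proj₂ (f 0)) ≡⟨ +-suc k (proj₂ (f 0)) ⟩
  suc k + proj₂ (f 0)  ≤⟨ first-end≤last-end (suc k) G ⟩
  proj₂ (f (suc k))    ≡⟨ trans last (+-identityʳ o) ⟩
  o                    ∎) (<-irrefl refl)
  where open ≤-Reasoning
gaps⇒subset (suc m) k f o G a≤o o≤b last with m≤n⇒m<n∨m≡n o≤b
gaps⇒subset (suc m) k f o G a≤o o≤b last | inj₁ o<b
  with S , S≡ , out , inn ← gaps⇒subset m k f (suc o) G (m≤n⇒m≤1+n a≤o) o<b (trans last (+-suc o m))
  = outside ∷ S , S≡ , out′ , inn′
  where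
  out′ : ∀ x → x ∉ outside ∷ S → ∃[ i ] i ≤ k × proj₁ (f i) ≤ o + toℕ x × o + toℕ x < proj₂ (f i)
  out′ zero    _  rewrite +-identityʳ o = 0 , z≤n , a≤o , o<b
  out′ (suc x) x∉ rewrite +-suc o (toℕ x) = out x (x∉ ∘ Vec.there)
  inn′ : ∀ x → x ∈ outside ∷ S → ∃[ i ] i ≤ k × o + toℕ x ≡ proj₂ (f i)
  inn′ (suc x) (Vec.there x∈) rewrite +-suc o (toℕ x) = inn x x∈
-- The last block ends at `o + suc m`, so it cannot end at `o`.
gaps⇒subset (suc m) zero f o G a≤o o≤b last | inj₂ o≡b =
  contradiction (trans (sym last) (sym o≡b)) (m+1+n≢m o)
gaps⇒subset (suc m) (suc k) f o G a≤o o≤b last | inj₂ o≡b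
  with S , S≡ , out , inn ← gaps⇒subset m k (f ∘ suc) (suc o) (IsGapSequence-suc G) (≤-reflexive (second-start G o≡b))
    (≤-trans (≤-reflexive (sym (second-start G o≡b))) (ordered G 1 (s≤s z≤n))) (trans last (+-suc o m))
  = inside ∷ S , cong suc S≡ , out′ , inn′
  where
  out′ : ∀ x → x ∉ inside ∷ S → ∃[ i ] i ≤ suc k × proj₁ (f i) ≤ o + toℕ x × o + toℕ x < proj₂ (f i)
  out′ zero    0∉ = contradiction Vec.here 0∉
  out′ (suc x) x∉ rewrite +-suc o (toℕ x) = let i , i≤k , p = out x (x∉ ∘ Vec.there) in suc i , s≤s i≤k , p
  inn′ : ∀ x → x ∈ inside ∷ S → ∃[ i ] i ≤ suc k × o + toℕ x ≡ proj₂ (f i)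
  inn′ zero    _              = 0 , z≤n , trans (+-identityʳ o) o≡b
  inn′ (suc x) (Vec.there x∈) rewrite +-suc o (toℕ x) = let i , i≤k , p = inn x x∈ in suc i , s≤s i≤k , p

-- Membership in tuples, pigeonhole, and vectors of witnesses

module _ {A : Set} where

  ∈-tuples⁺ : ∀ n {xs t : List A} → length t ≡ n → All (List._∈ xs) t → t List.∈ tuples n xs
  ∈-tuples⁺ zero    {t = []}    refl []           = here refl
  ∈-tuples⁺ (suc n) {t = x ∷ t} eq   (x∈ ∷ t∈) =
    ∈-cartesianProductWith⁺ _∷_ x∈ (∈-tuples⁺ n (suc-injective eq) t∈)

  ∈-tuples⁻ : ∀ n {xs t : List A} → t List.∈ tuples n xs → length t ≡ n × All (List._∈ xs) t
  ∈-tuples⁻ zero    (here refl) = refl , []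
  ∈-tuples⁻ (suc n) {xs} t∈ with x , t , x∈ , t∈′ , refl ← ∈-cartesianProductWith⁻ _∷_ xs (tuples n xs) t∈
    with eq , all ← ∈-tuples⁻ n t∈′ = cong suc eq , x∈ ∷ all

  tuples-unique : ∀ n {xs : List A} → Unique xs → Unique (tuples n xs)
  tuples-unique zero    xs! = [] ∷ []
  tuples-unique (suc n) xs! = Unique.cartesianProductWith⁺ _∷_ ∷-injective xs! (tuples-unique n xs!)

  lookup-injective : ∀ {xs : List A} → Unique xs → Injective _≡_ _≡_ (lookup xs)
  lookup-injective (_  ∷ _)   {zero}  {zero}  eq = refl
  lookup-injective (x≢ ∷ _)   {zero}  {suc j} eq = contradiction eq (All.lookup x≢ (∈-lookup j))
  lookup-injective (x≢ ∷ _)   {suc i} {zero}  eq = contradiction (sym eq) (All.lookup x≢ (∈-lookup i))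
  lookup-injective (_  ∷ xs!) {suc i} {suc j} eq = cong suc (lookup-injective xs! eq)

-- Pigeonhole: a missed value would extend f to an injection from m + 1 elements into n ≤ m.
injective⇒surjective : ∀ {m n} {f : Fin m → Fin n} → n ≤ m → Injective _≡_ _≡_ f → ∀ y → ∃[ x ] f x ≡ y
injective⇒surjective {m} {n} {f} n≤m f-inj y with Fin.any? (λ x → f x Fin.≟ y)
... | yes x,fx≡y = x,fx≡y
... | no ∄x      = contradiction (≤-trans (Fin.injective⇒≤ g-inj) n≤m) 1+n≰n
  where
  g : Fin (suc m) → Fin n
  g zero    = y
  g (suc x) = f x
  g-inj : Injective _≡_ _≡_ g
  g-inj {zero}  {zero}  eq = refl
  g-inj {zero}  {suc x} eq = contradiction (x , sym eq) ∄x
  g-inj {suc x} {zero}  eq = contradiction (x , eq) ∄x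
  g-inj {suc x} {suc z} eq = cong suc (f-inj eq)

-- This collects separate witnesses, one for each literal of a clause, into a single index vector of
-- exact length n, the shape carried by a vertex.
choose : ∀ {A : Set} {k} {R : ℕ → A → Set} n {C : List A} → length C ≤ n →
  All (λ c → ∃[ i ] i ≤ k × R i c) C →
  ∃[ J ] length J ≡ n × All (_≤ k) J × All (λ c → Any (λ i → R i c) J) C
choose zero    {[]} _ [] = [] , refl , [] , []
-- Surplus entries are filled with the index 0, which is at most any k.
choose {R = R} (suc n) {[]} _ [] with J , eq , J≤ , _ ← choose {R = R} n {[]} z≤n [] =
  0 ∷ J , cong suc eq , z≤n ∷ J≤ , []
choose (suc n) {c ∷ C} (s≤s C≤) ((i , i≤k , r) ∷ rs) with J , eq , J≤ , rs′ ← choose n C≤ rs =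
  i ∷ J , cong suc eq , i≤k ∷ J≤ , here r ∷ All.map there rs′

-- The reduction

-- A triple (i , a , b) stands for the i-th block with end points a and b.
Block : Set
Block = ℕ × ℕ × ℕ

-- A literal (p , x) is positive iff p is true.
FalseAt : Block → Bool × ℕ → Set
FalseAt (i , a , b) (p , x) = (T p × a ≤ x × x < b) ⊎ (¬ T p × x ≡ b)

Clash : Block → Block → Set
Clash (i , a , b) (j , c , e) = (i ≡ j × ¬ (a ≡ c × b ≡ e)) ⊎ (j ≡ suc i × c ≢ suc b)

-- Both directions are included to make the graph symmetric.
Conflict : List Block → List Block → Set
Conflict us vs = Any (λ u → Any (λ v → Clash u v ⊎ Clash v u) vs) us

-- The boundary conditions at the indices 0 and k are implications, written as disjunctions to be
-- decided by `pd-⊎`.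
Valid : ℕ → ℕ → Block → Set
Valid n k (i , a , b) = a ≤ b × (i ≢ 0 ⊎ a ≡ 0) × (i ≢ k ⊎ b ≡ n)

Violated : List Block → List (Bool × ℕ) → Set
Violated us C = All (λ ℓ → Any (λ u → FalseAt u ℓ) us) C

-- A formula and its parameter, with variables as plain numbers and without the proof about clause
-- width, so that it belongs to a type of the universe `Ty`.
RawInput : Set
RawInput = (ℕ × List (List (Bool × ℕ))) × ℕ

-- Excluding conflicts of a tuple with itself makes the graph loopless.
Good : RawInput → List Block → Set
Good ((n , Cs) , k) us = All (Valid n k) us × ¬ Conflict us us × ¬ Any (Violated us) Cs

falseAt? : ∀ ((u , ℓ) : Block × (Bool × ℕ)) → Dec (FalseAt u ℓ)
falseAt? ((i , a , b) , (p , x)) = (T? p ×-dec a ≤? x ×-dec suc x ≤? b) ⊎-dec (¬? (T? p) ×-dec x ≟ b)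

clash? : ∀ ((u , v) : Block × Block) → Dec (Clash u v)
clash? ((i , a , b) , (j , c , e)) = (i ≟ j ×-dec ¬? (a ≟ c ×-dec b ≟ e)) ⊎-dec (j ≟ suc i ×-dec ¬? (c ≟ suc b))

conflict? : ∀ ((us , vs) : List Block × List Block) → Dec (Conflict us vs)
conflict? (us , vs) = any? (λ u → any? (λ v → clash? (u , v) ⊎-dec clash? (v , u)) vs) us

valid? : ∀ (((n , k) , u) : (ℕ × ℕ) × Block) → Dec (Valid n k u)
valid? ((n , k) , (i , a , b)) = a ≤? b ×-dec (¬? (i ≟ 0) ⊎-dec a ≟ 0) ×-dec (¬? (i ≟ k) ⊎-dec b ≟ n)

violated? : ∀ ((us , C) : List Block × List (Bool × ℕ)) → Dec (Violated us C)
violated? (us , C) = all? (λ ℓ → any? (λ u → falseAt? (u , ℓ)) us) C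

good? : ∀ ((γ , us) : RawInput × List Block) → Dec (Good γ us)
good? (((n , Cs) , k) , us) = all? (λ u → valid? ((n , k) , u)) us ×-dec ¬? (conflict? (us , us)) ×-dec
                              ¬? (any? (λ C → violated? (us , C)) Cs)

blocks : RawInput → List Block
blocks ((n , _) , k) = cartesianProduct (downFrom (suc k))
  (cartesianProduct (downFrom (suc n)) (downFrom (suc n)))

vertices : ℕ → RawInput → List (List Block)
vertices D γ = filter (λ us → good? (γ , us)) (tuples D (blocks γ))

adjacency : ℕ → RawInput → List (List Bool)
adjacency D γ = map (λ u → map (λ v → does (conflict? (u , v))) (vertices D γ)) (vertices D γ)

-- Polynomial-time computability of the reduction

`lit `block `input : Ty
`lit   = bool `× nat
`block = nat `× nat `× nat
`input = (nat `× list (list `lit)) `× nat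

pd-falseAt : PolyDec (`block `× `lit) falseAt?
pd-falseAt = pd-⊎ (pd-× (pd-T p) (pd-× (pd-≤ a x) (pd-≤ (pt-suc x) b))) (pd-× (pd-¬ (pd-T p)) (pd-≟ x b))
  where
  a = pt-fst (pt-snd (pt-fst pt-id))
  b = pt-snd (pt-snd (pt-fst pt-id))
  p = pt-fst (pt-snd pt-id)
  x = pt-snd (pt-snd pt-id)

pd-clash : PolyDec (`block `× `block) clash?
pd-clash = pd-⊎ (pd-× (pd-≟ i j) (pd-¬ (pd-× (pd-≟ a c) (pd-≟ b e))))
                (pd-× (pd-≟ j (pt-suc i)) (pd-¬ (pd-≟ c (pt-suc b))))
  where
  i = pt-fst (pt-fst pt-id)
  a = pt-fst (pt-snd (pt-fst pt-id))
  b = pt-snd (pt-snd (pt-fst pt-id))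
  j = pt-fst (pt-snd pt-id)
  c = pt-fst (pt-snd (pt-snd pt-id))
  e = pt-snd (pt-snd (pt-snd pt-id))

pd-conflict : PolyDec (list `block `× list `block) conflict?
pd-conflict = pd-any (pt-fst pt-id) (pd-any (pt-snd (pt-fst pt-id))
  (pd-⊎ (pd-∘ pd-clash (pt-pair u v)) (pd-∘ pd-clash (pt-pair v u))))
  where
  u = pt-snd (pt-fst pt-id)
  v = pt-snd pt-id

pd-valid : PolyDec ((nat `× nat) `× `block) valid?
pd-valid = pd-× (pd-≤ a b) (pd-× (pd-⊎ (pd-¬ (pd-≟ i pt-zero)) (pd-≟ a pt-zero))
                                   (pd-⊎ (pd-¬ (pd-≟ i k)) (pd-≟ b n)))
  where
  n = pt-fst (pt-fst pt-id)
  k = pt-snd (pt-fst pt-id)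
  i = pt-fst (pt-snd pt-id)
  a = pt-fst (pt-snd (pt-snd pt-id))
  b = pt-snd (pt-snd (pt-snd pt-id))

pd-violated : PolyDec (list `block `× list `lit) violated?
pd-violated = pd-all (pt-snd pt-id) (pd-any (pt-fst (pt-fst pt-id))
  (pd-∘ pd-falseAt (pt-pair (pt-snd pt-id) (pt-snd (pt-fst pt-id)))))

pd-good : PolyDec (`input `× list `block) good?
pd-good = pd-×
  (pd-all us (pd-∘ pd-valid (pt-pair (pt-pair (pt-∘ n (pt-fst pt-id)) (pt-∘ k (pt-fst pt-id))) (pt-snd pt-id))))
  (pd-× (pd-¬ (pd-∘ pd-conflict (pt-pair us us)))
        (pd-¬ (pd-any (pt-snd (pt-fst (pt-fst pt-id)))
          (pd-∘ pd-violated (pt-pair (pt-∘ us (pt-fst pt-id)) (pt-snd pt-id))))))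
  where
  us = pt-snd pt-id
  n  = pt-fst (pt-fst (pt-fst pt-id))
  k  = pt-snd (pt-fst pt-id)

pt-blocks : PolyTime `input (list `block) blocks
pt-blocks = product (pt-downFrom (pt-suc (pt-snd pt-id))) (product m m)
  where
  m = pt-downFrom (pt-suc (pt-fst (pt-fst pt-id)))
  product : ∀ {Γ α β} {xs : El Γ → List (El α)} {ys : El Γ → List (El β)} →
            PolyTime Γ (list α) xs → PolyTime Γ (list β) ys →
            PolyTime Γ (list (α `× β)) (λ γ → cartesianProduct (xs γ) (ys γ))
  product P Q = pt-cartesianProductWith P Q pt-id

pt-vertices : ∀ D → PolyTime `input (list (list `block)) (vertices D)
pt-vertices D = pt-filter (pt-tuples D pt-blocks) pd-good

pt-adjacency : ∀ D → PolyTime `input (list (list bool)) (adjacency D)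
pt-adjacency D = pt-map (pt-vertices D) (pt-map (pt-∘ (pt-vertices D) (pt-fst pt-id))
  (decides (pd-∘ pd-conflict (pt-pair (pt-snd (pt-fst pt-id)) (pt-snd pt-id)))))

reduction : ℕ → ℕ → RawInput → (ℕ × List (List (List Bool) × List (List Bool))) × ℕ
reduction κ D γ@(_ , k) = (length (vertices D γ) , replicate κ (adjacency D γ , adjacency D γ)) , suc k ^ D

pt-reduction : ∀ κ D →
  PolyTime `input ((nat `× list (list (list bool) `× list (list bool))) `× nat) (reduction κ D)
pt-reduction κ D = pt-pair (pt-pair (pt-length (pt-vertices D))
                                    (copies κ (pt-pair (pt-adjacency D) (pt-adjacency D))))
                           (pt-^ D (pt-suc (pt-snd pt-id)))
  where
  copies : ∀ {Γ τ} {F : El Γ → El τ} n → PolyTime Γ τ F → PolyTime Γ (list τ) (λ γ → replicate n (F γ))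
  copies zero    P = pt-[]
  copies (suc n) P = pt-∷ P (copies n P)

-- The constructed instance and its encoding

vertices-good : ∀ D γ i → lookup (vertices D γ) i List.∈ tuples D (blocks γ) × Good γ (lookup (vertices D γ) i)
vertices-good D γ i = ∈-filter⁻ (λ us → good? (γ , us)) (∈-lookup i)

vertices-unique : ∀ D γ → Unique (vertices D γ)
vertices-unique D ((n , _) , k) = Unique.filter⁺ _ (tuples-unique D
  (Unique.cartesianProduct⁺ (Unique.downFrom⁺ (suc k))
    (Unique.cartesianProduct⁺ (Unique.downFrom⁺ (suc n)) (Unique.downFrom⁺ (suc n)))))

graph : ∀ D γ → Digraph (length (vertices D γ))
graph D γ = record
  { arc      = λ u v → does (conflict? (lookup (vertices D γ) u , lookup (vertices D γ) v))
  ; loopless = λ v → dec-false (conflict? _) (let _ , _ , ¬c , _ = vertices-good D γ v in ¬c)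
  }

pairs : ∀ κ → ℕ → RawInput → DigraphPairs κ
pairs κ D γ = record { order = length (vertices D γ) ; A = λ _ → graph D γ ; B = λ _ → graph D γ }

-- The program produces lists, whereas the problem encodes graphs by `tabulate`. The trees agree
-- because tabulating along `lookup` is mapping over the list.
encode-pairs : ∀ κ D γ → ParameterizedProblem.encode (CompatibleBoundedOrdering κ) (pairs κ D γ) ≡
  enc (nat `× list (list (list bool) `× list (list bool))) (proj₁ (reduction κ D γ))
encode-pairs κ D γ = cong (cons _)
  (trans (cong (λ M → ⌜ tabulate {n = κ} (λ _ → cons M M) ⌝List) encode-graph) (copies κ))
  where
  L = vertices D γ
  tabulate-lookup-map : ∀ {A B : Set} (f : A → B) xs → tabulate (f ∘ lookup xs) ≡ map f xs
  tabulate-lookup-map f xs = trans (sym (map-tabulate (lookup xs) f)) (cong (map f) (tabulate-lookup xs))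
  encode-graph : ⌜ graph D γ ⌝Digraph ≡ enc (list (list bool)) (adjacency D γ)
  encode-graph = cong ⌜_⌝List (trans
    (tabulate-lookup-map (λ u → ⌜ tabulate (λ v → ⌜ does (conflict? (u , lookup L v)) ⌝𝔹) ⌝List) L)
    (trans (map-cong (λ u → cong ⌜_⌝List
             (trans (tabulate-lookup-map (λ v → ⌜ does (conflict? (u , v)) ⌝𝔹) L) (map-∘ L))) L)
           (map-∘ L)))
  copies : ∀ n → ⌜ tabulate {n = n} (λ _ → _) ⌝List ≡
           enc (list (list (list bool) `× list (list bool))) (replicate n _)
  copies zero    = refl
  copies (suc n) = cong (cons _) (copies n)

rawLiteral : ∀ {n} → Literal n → Bool × ℕ
rawLiteral (pos x) = true  , toℕ x
rawLiteral (neg x) = false , toℕ x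

raw : ∀ {d} → CNF d → ℕ × List (List (Bool × ℕ))
raw φ = CNF.vars φ , map (map rawLiteral) (CNF.clauses φ)

encode-CNF : ∀ {d} (φ : CNF d) → enc (nat `× list (list `lit)) (raw φ) ≡ ParameterizedProblem.encode (WSat d) φ
encode-CNF φ = cong (λ Cs → cons ⌜ vars ⌝ℕ ⌜ Cs ⌝List) (trans (sym (map-∘ clauses))
  (map-cong (λ C → cong ⌜_⌝List (trans (sym (map-∘ C)) (map-cong encode-literal C))) clauses))
  where
  open CNF φ
  encode-literal : ∀ ℓ → enc `lit (rawLiteral ℓ) ≡ ⌜ ℓ ⌝Lit
  encode-literal (pos x) = refl
  encode-literal (neg x) = refl

-- The vectors of indices that the D blocks of a vertex can have; their number is the new parameter.
positions : ℕ → ℕ → List (List ℕ)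
positions D k = tuples D (downFrom (suc k))

length-positions : ∀ D k → length (positions D k) ≡ suc k ^ D
length-positions D k = trans (length-tuples D (downFrom (suc k))) (cong (_^ D) (length-downFrom (suc k)))

∈-positions : ∀ D k {J} → length J ≡ D → All (_≤ k) J → J List.∈ positions D k
∈-positions D k eq J≤ = ∈-tuples⁺ D eq (All.map (∈-downFrom⁺ ∘ s≤s) J≤)

∈-replicate : ∀ {A : Set} {n} {x : A} → 0 < n → x List.∈ replicate n x
∈-replicate {n = suc n} _ = here refl

module _ {κ d D : ℕ} (d<D : d < D) (φ : CNF d) (k : ℕ) where
  open CNF φ

  private
    γ : RawInput
    γ = raw φ , k
    L : List (List Block)
    L = vertices D γ

  -- From a satisfying set to an ordering

  module _ (S : Subset vars) (∣S∣≡k : ∣ S ∣ ≡ k) (sat : All (Any (Satisfies S)) clauses) where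

    private
      f : ℕ → ℕ × ℕ
      f = gap 0 0 S

      tuple : List ℕ → List Block
      tuple = map (λ i → i , f i)

      f-valid : ∀ {i} → i ≤ k → Valid vars k (i , f i)
      f-valid {i} i≤k = gap-ordered z≤n S i , first i , last
        where
        first : ∀ i → i ≢ 0 ⊎ proj₁ (f i) ≡ 0
        first zero    = inj₂ (gap-first 0 0 S)
        first (suc i) = inj₁ λ ()
        last : i ≢ k ⊎ proj₂ (f i) ≡ vars
        last with i ≟ k
        ... | yes refl = inj₂ (trans (cong (proj₂ ∘ f) (sym ∣S∣≡k)) (gap-last 0 0 S))
        ... | no i≢k   = inj₁ i≢k

      f-clash-free : ∀ {i j} → i ≤ k → j ≤ k → ¬ Clash (i , f i) (j , f j)
      f-clash-free i≤k j≤k (inj₁ (refl , ≢))  = ≢ (refl , refl)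
      f-clash-free {i} i≤k j≤k (inj₂ (refl , ≢)) = ≢ (gap-link 0 0 S i (subst (i <_) (sym ∣S∣≡k) j≤k))

      f-block : ∀ {i} → i ≤ k → (i , f i) List.∈ blocks γ
      f-block {i} i≤k = ∈-cartesianProduct⁺ (∈-downFrom⁺ (s≤s i≤k)) (∈-cartesianProduct⁺
        (∈-downFrom⁺ (s≤s (≤-trans (gap-ordered z≤n S i) (gap-end-≤ 0 0 S i))))
        (∈-downFrom⁺ (s≤s (gap-end-≤ 0 0 S i))))

      tuple-conflict-free : ∀ {J J′} → All (_≤ k) J → All (_≤ k) J′ → ¬ Conflict (tuple J) (tuple J′)
      tuple-conflict-free J≤ J′≤ conflict
        with u , u∈ , c ← List.find conflict
        with v , v∈ , clash ← List.find c
        with i , i∈ , refl ← ∈-map⁻ (λ i → i , f i) u∈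
        with j , j∈ , refl ← ∈-map⁻ (λ i → i , f i) v∈
        with clash
      ... | inj₁ c = f-clash-free (All.lookup J≤ i∈) (All.lookup J′≤ j∈) c
      ... | inj₂ c = f-clash-free (All.lookup J′≤ j∈) (All.lookup J≤ i∈) c

      satisfied⇒¬FalseAt : ∀ ℓ i → Satisfies S ℓ → ¬ FalseAt (i , f i) (rawLiteral ℓ)
      satisfied⇒¬FalseAt (pos x) i x∈S (inj₁ (_ , a≤x , x<b)) = gap-interior 0 0 S i x a≤x x<b x∈S
      satisfied⇒¬FalseAt (pos x) i x∈S (inj₂ (¬t , _))        = ¬t _
      satisfied⇒¬FalseAt (neg x) i x∉S (inj₂ (_ , x≡b))       = x∉S (gap-boundary 0 0 S i x x≡b)

      tuple-¬Violated : ∀ J {C} → Any (Satisfies S) C → ¬ Violated (tuple J) (map rawLiteral C)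
      tuple-¬Violated J sat violated
        with ℓ , ℓ∈ , sat-ℓ ← List.find sat
        with u , u∈ , false-u ← List.find (All.lookup violated (∈-map⁺ rawLiteral ℓ∈))
        with i , _ , refl ← ∈-map⁻ (λ i → i , f i) u∈
        = satisfied⇒¬FalseAt ℓ i sat-ℓ false-u

      tuple-good : ∀ {J} → All (_≤ k) J → Good γ (tuple J)
      tuple-good {J} J≤ = All.map⁺ (All.map f-valid J≤) , tuple-conflict-free J≤ J≤ , λ violated →
        let C , C∈ , v       = List.find violated
            C′ , C′∈ , C≡ = ∈-map⁻ (map rawLiteral) C∈
        in tuple-¬Violated J (All.lookup sat C′∈) (subst (Violated (tuple J)) C≡ v)

      J : Fin (length (positions D k)) → List ℕ
      J = lookup (positions D k)

      J-length×J≤ : ∀ p → length (J p) ≡ D × All (_≤ k) (J p)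
      J-length×J≤ p = let eq , J∈ = ∈-tuples⁻ D (∈-lookup p) in eq , All.map (s≤s⁻¹ ∘ ∈-downFrom⁻) J∈

      tuple∈L : ∀ p → tuple (J p) List.∈ L
      tuple∈L p = let eq , J≤ = J-length×J≤ p in
        ∈-filter⁺ (λ us → good? (γ , us))
          (∈-tuples⁺ D (trans (length-map _ (J p)) eq) (All.map⁺ (All.map f-block J≤))) (tuple-good J≤)

      s : Fin (length (positions D k)) → Fin (length L)
      s p = Any.index (tuple∈L p)

      lookup-s : ∀ p → lookup L (s p) ≡ tuple (J p)
      lookup-s p = sym (Any.lookup-index (tuple∈L p))

      map-proj₁-tuple : ∀ J → map proj₁ (tuple J) ≡ J
      map-proj₁-tuple J = trans (sym (map-∘ J)) (map-id J)

      -- The index vector can be read off a tuple, so different vectors give different vertices.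
      s-injective : Injective _≡_ _≡_ s
      s-injective {p} {q} sp≡sq = lookup-injective (tuples-unique D (Unique.downFrom⁺ (suc k)))
        (trans (sym (map-proj₁-tuple (J p)))
               (trans (cong (map proj₁) (index-injective (setoid _) (tuple∈L p) (tuple∈L q) sp≡sq))
                      (map-proj₁-tuple (J q))))

      ¬arc : ∀ p q → does (conflict? (lookup L (s p) , lookup L (s q))) ≡ false
      ¬arc p q = dec-false (conflict? (lookup L (s p) , lookup L (s q)))
        (subst₂ (λ us vs → ¬ Conflict us vs) (sym (lookup-s p)) (sym (lookup-s q))
          (tuple-conflict-free (proj₂ (J-length×J≤ p)) (proj₂ (J-length×J≤ q))))

    -- All blocks stem from the one sequence of S, so the chosen vertices are pairwise non-adjacent
    -- and may be listed in any order with any label.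
    satisfying⇒ordering : Fin κ → CompatibleOrdering (pairs κ D γ) (length (positions D k))
    satisfying⇒ordering ℓ₀ = record
      { s        = s
      ; distinct = s-injective
      ; ℓ        = λ _ → ℓ₀
      ; sink     = λ p q _ → ¬arc p q
      ; source   = λ p q _ → ¬arc q p
      }

  -- From an ordering to a satisfying set

  module _ {b′ : ℕ} (b≤b′ : length (positions D k) ≤ b′) (ordering : CompatibleOrdering (pairs κ D γ) b′) where
    open CompatibleOrdering ordering

    private
      tuple : Fin b′ → List Block
      tuple p = lookup L (s p)

      does-false : ∀ {A : Set} (a? : Dec A) → does a? ≡ false → ¬ A
      does-false a? eq a = contradiction (trans (sym (dec-true a? a)) eq) λ ()

      -- Adjacency is symmetric, so the sink condition at the earlier of two vertices excludes
      -- clashes in both directions. Within a single vertex they are excluded by `Good`.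
      clash-free : ∀ p q {u v} → u List.∈ tuple p → v List.∈ tuple q → ¬ Clash u v
      clash-free p q u∈ v∈ clash with Fin.<-cmp p q
      ... | tri< p<q _ _ = does-false (conflict? (tuple p , tuple q)) (sink p q p<q)
        (List.lose u∈ (List.lose v∈ (inj₁ clash)))
      ... | tri≈ _ refl _ = let _ , _ , ¬c , _ = vertices-good D γ (s p)
        in ¬c (List.lose u∈ (List.lose v∈ (inj₁ clash)))
      ... | tri> _ _ q<p = does-false (conflict? (tuple q , tuple p)) (sink q p q<p)
        (List.lose v∈ (List.lose u∈ (inj₂ clash)))

      same-position : ∀ p q {i x y} → (i , x) List.∈ tuple p → (i , y) List.∈ tuple q → x ≡ y
      same-position p q {i} {a , b} {c , e} u∈ v∈ with a ≟ c ×-dec b ≟ e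
      ... | yes (refl , refl) = refl
      ... | no ≢              = contradiction (inj₁ (refl , ≢)) (clash-free p q u∈ v∈)

      position : Fin b′ → List ℕ
      position p = map proj₁ (tuple p)

      position∈ : ∀ p → position p List.∈ positions D k
      position∈ p = let t∈ , _ = vertices-good D γ (s p)
                        eq , all = ∈-tuples⁻ D t∈
        in ∈-tuples⁺ D (trans (length-map proj₁ (tuple p)) eq)
             (All.map⁺ (All.map (proj₁ ∘ ∈-cartesianProduct⁻ (downFrom (suc k)) gaps) all))
        where
        gaps : List (ℕ × ℕ)
        gaps = cartesianProduct (downFrom (suc vars)) (downFrom (suc vars))

      agree : ∀ us vs → map proj₁ us ≡ map proj₁ vs →
              (∀ {i : ℕ} {x y : ℕ × ℕ} → (i , x) List.∈ us → (i , y) List.∈ vs → x ≡ y) → us ≡ vs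
      agree []             []             eq same = refl
      agree ((i , x) ∷ us) ((j , y) ∷ vs) eq same with refl ← ∷-injectiveˡ eq =
        cong₂ _∷_ (cong (i ,_) (same (here refl) (here refl)))
                  (agree us vs (∷-injectiveʳ eq) (λ u∈ v∈ → same (there u∈) (there v∈)))

      index : Fin b′ → Fin (length (positions D k))
      index p = Any.index (position∈ p)

      -- Two vertices of the ordering with the same index vector cannot clash, so their blocks agree
      -- entry by entry.
      index-inj : Injective _≡_ _≡_ index
      index-inj {p} {q} eq = distinct (lookup-injective (vertices-unique D γ)
        (agree (tuple p) (tuple q) (index-injective (setoid _) (position∈ p) (position∈ q) eq)
          (same-position p q)))

      -- There are at least as many vertices as index vectors and no vector occurs twice, so each
      -- occurs.
      position-surjective : ∀ {J} → J List.∈ positions D k → ∃[ p ] position p ≡ J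
      position-surjective J∈ = let p , eq = injective⇒surjective {f = index} b≤b′ index-inj (Any.index J∈)
        in p , index-injective (setoid _) (position∈ p) J∈ eq

      selected : ∀ i → i ≤ k → ∃[ x ] ∃[ p ] (i , x) List.∈ tuple p
      selected i i≤k =
        -- The vertex at the constant vector of i's contains a block of index i, as D is positive
        -- even for d = 0.
        let p , eq             = position-surjective (∈-positions D k {replicate D i}
                                   (length-replicate D) (All.replicate⁺ D i≤k))
            i∈                 = subst (i List.∈_) (sym eq) (∈-replicate (≤-trans (s≤s z≤n) d<D))
            (j , x) , u∈ , i≡j = ∈-map⁻ proj₁ {xs = tuple p} i∈
        in x , p , subst (λ j → (j , x) List.∈ tuple p) (sym i≡j) u∈

      Selects : (ℕ → ℕ × ℕ) → Set
      Selects f = ∀ i → i ≤ k → ∃[ p ] (i , f i) List.∈ tuple p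

      selection : ∃[ f ] Selects f
      -- Capping the index at k makes the choice a total function.
      selection = (λ i → proj₁ (selected (i ⊓ k) (m⊓n≤n i k))) , λ i i≤k →
        let x , p , u∈ = selected (i ⊓ k) (m⊓n≤n i k)
        in p , subst (λ j → (j , x) List.∈ tuple p) (m≤n⇒m⊓n≡m i≤k) u∈

      satisfies? : ∀ (S : Subset vars) ℓ → Dec (Satisfies S ℓ)
      satisfies? S (pos x) = x ∈? S
      satisfies? S (neg x) = ¬? (x ∈? S)

      module _ (f : ℕ → ℕ × ℕ) (f-selected : Selects f) where

        f-valid : ∀ i → i ≤ k → Valid vars k (i , f i)
        f-valid i i≤k = let p , u∈ = f-selected i i≤k
                            _ , valid , _ = vertices-good D γ (s p)
          in All.lookup valid u∈

        f-linked : ∀ i → i < k → proj₁ (f (suc i)) ≡ suc (proj₂ (f i))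
        f-linked i i<k = decidable-stable (proj₁ (f (suc i)) ≟ suc (proj₂ (f i))) λ ≢ →
          let p , u∈ = f-selected i (<⇒≤ i<k)
              q , v∈ = f-selected (suc i) i<k
          in clash-free p q u∈ v∈ (inj₂ (refl , ≢))

        f-gaps : IsGapSequence k f
        f-gaps = record { ordered = λ i i≤k → proj₁ (f-valid i i≤k) ; linked = f-linked }

        FalsifiedBy : ℕ → Literal vars → Set
        FalsifiedBy i ℓ = FalseAt (i , f i) (rawLiteral ℓ)

        -- The block `f i` may have been selected from another vertex, but `same-position` forces
        -- the block of index i in `tuple p` to coincide with it.
        at-tuple : ∀ {J p ℓ} → All (_≤ k) J → position p ≡ J → Any (λ i → FalsifiedBy i ℓ) J →
                   Any (λ u → FalseAt u (rawLiteral ℓ)) (tuple p)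
        at-tuple {J} {p} {ℓ} J≤ position≡J any =
          let i , i∈ , false-i   = List.find any
              (j , x) , u∈ , i≡j = ∈-map⁻ proj₁ {xs = tuple p} (subst (i List.∈_) (sym position≡J) i∈)
              u∈′                = subst (λ j → (j , x) List.∈ tuple p) (sym i≡j) u∈
              q , v∈             = f-selected i (All.lookup J≤ i∈)
          in List.lose u∈′ (subst (λ y → FalseAt (i , y) (rawLiteral ℓ)) (same-position q p v∈ u∈′) false-i)

        -- An unsatisfied clause supplies one index per literal. As d ≤ D, these fit into one
        -- vector, and the vertex at that vector would violate the clause, contrary to `Good`.
        all-satisfied : ∀ (S : Subset vars) →
          (∀ ℓ → ¬ Satisfies S ℓ → ∃[ i ] i ≤ k × FalsifiedBy i ℓ) → All (Any (Satisfies S)) clauses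
        all-satisfied S falsified = All.tabulate λ {C} C∈ → decidable-stable (any? (satisfies? S) C) λ ¬sat →
          let J , eq , J≤ , falseAt = choose D (≤-trans (All.lookup width C∈) (<⇒≤ d<D))
                                        (All.map (λ {ℓ} → falsified ℓ) (All.¬Any⇒All¬ C ¬sat))
              p , position≡J        = position-surjective (∈-positions D k eq J≤)
              _ , _ , _ , ¬violated = vertices-good D γ (s p)
          in ¬violated (List.lose (∈-map⁺ (map rawLiteral) C∈)
               (All.map⁺ (All.map (λ {ℓ} → at-tuple {p = p} {ℓ = ℓ} J≤ position≡J) falseAt)))

      implied : ∀ {A B : Set} → A → ¬ A ⊎ B → B
      implied a (inj₁ ¬a) = contradiction a ¬a
      implied a (inj₂ b)  = b

    ordering⇒satisfying : ∃[ S ] ∣ S ∣ ≡ k × All (Any (Satisfies S)) clauses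
    ordering⇒satisfying =
      let f , sel = selection
          S , ∣S∣≡k , interior , boundary = gaps⇒subset vars k f 0 (f-gaps f sel)
             (≤-reflexive (implied refl (proj₁ (proj₂ (f-valid f sel 0 z≤n))))) z≤n
             (implied refl (proj₂ (proj₂ (f-valid f sel k ≤-refl))))
      in S , ∣S∣≡k , all-satisfied f sel S λ where
        (pos x) x∉S  → let i , i≤k , a≤x , x<b = interior x x∉S in i , i≤k , inj₁ (_ , a≤x , x<b)
        (neg x) ¬x∉S → let i , i≤k , x≡b = boundary x (decidable-stable (x ∈? S) ¬x∉S)
          in i , i≤k , inj₂ (id , x≡b)

-- Parameterized reductions

Computable-PolyTime : ∀ {f h} → Computable f → PolyTime nat nat h → Computable (h ∘ f)
Computable-PolyTime {f} (p , p-runs) (polyTime h) = p ⨾ prog h , λ n →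
  let _ , d = p-runs n ; _ , _ , e = run h (f n) in _ , ⇓seq d e

open ParameterizedProblem

-- The intermediate instance is no larger than the time t of the first reduction. A polynomial in t
-- ≤ f(k) · n ^ c splits into a factor in k and a power of n, so the composite is again
-- fixed-parameter tractable.
≤fpt-polyTime : ∀ {P Q R} (ρ : Instance Q × ℕ → Instance R × ℕ) {h : ℕ → ℕ} →
  P ≤fpt Q →
  (∀ x k → Yes Q x k ⇔ Yes R (proj₁ (ρ (x , k))) (proj₂ (ρ (x , k)))) →
  (∀ x {k l} → k ≤ l → proj₂ (ρ (x , k)) ≤ h l) →
  PolyTime nat nat h →
  input Q ⇝ input R ∘ ρ →
  P ≤fpt R
≤fpt-polyTime {P} {Q} {R} ρ {h} P≤Q ρ-correct ρ-bound h-polyTime M = record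
  { reduce       = ρ ∘ reduce
  ; correct      = λ x k → ρ-correct (proj₁ (reduce (x , k))) (proj₂ (reduce (x , k))) ⇔-∘ correct x k
  ; g            = h ∘ g
  ; g-computable = Computable-PolyTime g-computable h-polyTime
  ; g-bound      = λ x k → ρ-bound (proj₁ (reduce (x , k))) (g-bound x k)
  ; f            = λ k → (2 + f k) ^ degree q
  ; f-computable = Computable-PolyTime f-computable (pt-^ (degree q) (pt-suc (pt-suc pt-id)))
  ; c            = c * degree q
  ; program      = program ⨾ prog M
  ; runs         = runs′
  }
  where
  open _≤fpt_ P≤Q
  q : Bound
  q = var ⊕ time M

  runs′ : ∀ x k → ∃[ t ] t ≤ (2 + f k) ^ degree q * size (encode P x) ^ (c * degree q) ×
          program ⨾ prog M ⊢ input P (x , k) ⇓[ t ] input R (ρ (reduce (x , k)))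
  runs′ x k =
    let t , t≤ , d = runs x k
        u , u≤ , e = run M (reduce (x , k))
    in t + u , (begin
      t + u                              ≤⟨ +-monoʳ-≤ t (≤-trans u≤ (⟦⟧-mono (time M) (size≤time d))) ⟩
      ⟦ q ⟧ t                            ≤⟨ ⟦⟧≤^degree q t ⟩
      (2 + t) ^ degree q                 ≤⟨ ^-monoˡ-≤ (degree q) (2+t≤ t≤) ⟩
      ((2 + f k) * n ^ c) ^ degree q     ≡⟨ ^-distribʳ-* (degree q) (2 + f k) (n ^ c) ⟩
      (2 + f k) ^ degree q * (n ^ c) ^ degree q
                                         ≡⟨ cong ((2 + f k) ^ degree q *_) (^-*-assoc n c (degree q)) ⟩
      (2 + f k) ^ degree q * n ^ (c * degree q) ∎) , ⇓seq d e
    where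
    open ≤-Reasoning
    n = size (encode P x)
    -- As n ^ c is at least 1, the additive 2 can be moved into the factor that depends on k.
    2+t≤ : ∀ {t} → t ≤ f k * n ^ c → 2 + t ≤ (2 + f k) * n ^ c
    2+t≤ {t} t≤ = begin
      2 + t                       ≤⟨ +-mono-≤ (*-monoʳ-≤ 2 1≤n^c) t≤ ⟩
      2 * n ^ c + f k * n ^ c     ≡⟨ *-distribʳ-+ (n ^ c) 2 (f k) ⟨
      (2 + f k) * n ^ c           ∎
      where
      1≤n^c : 1 ≤ n ^ c
      1≤n^c = ≤-trans (≤-reflexive (sym (^-zeroˡ c))) (^-monoˡ-≤ c (1≤size (encode P x)))
    ^-distribʳ-* : ∀ e a b → (a * b) ^ e ≡ a ^ e * b ^ e
    ^-distribʳ-* zero    a b = refl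
    ^-distribʳ-* (suc e) a b = trans (cong (a * b *_) (^-distribʳ-* e a b)) (lemma a b (a ^ e) (b ^ e))
      where
      lemma : ∀ a b x y → a * b * (x * y) ≡ a * x * (b * y)
      lemma = solve-∀

WSat-≤fpt : ∀ {κ} d P → Fin κ → P ≤fpt WSat d → P ≤fpt CompatibleBoundedOrdering κ
WSat-≤fpt {κ} d P ℓ₀ P≤WSat = ≤fpt-polyTime ρ P≤WSat ρ-correct (λ _ k≤l → ^-monoˡ-≤ (suc d) (s≤s k≤l))
  (pt-^ (suc d) (pt-suc pt-id))
  (⇝-ext (λ (φ , k) → cong (λ x → cons x ⌜ k ⌝ℕ) (encode-CNF φ))
         (λ (φ , k) → cong (λ x → cons x ⌜ suc k ^ suc d ⌝ℕ) (sym (encode-pairs κ (suc d) (raw φ , k))))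
         (⇝-∘ (computes (pt-reduction κ (suc d))) (λ (φ , k) → raw φ , k)))
  where
  ρ : CNF d × ℕ → DigraphPairs κ × ℕ
  ρ (φ , k) = pairs κ (suc d) (raw φ , k) , suc k ^ suc d

  ρ-correct : ∀ φ k → Yes (WSat d) φ k ⇔
    (∃[ b′ ] suc k ^ suc d ≤ b′ × CompatibleOrdering (pairs κ (suc d) (raw φ , k)) b′)
  ρ-correct φ k = mk⇔
    (λ (S , S≡ , sat) → length (positions (suc d) k) , ≤-reflexive (sym (length-positions (suc d) k)) ,
                        satisfying⇒ordering ≤-refl φ k S S≡ sat ℓ₀)
    (λ (b′ , b≤ , ordering) →
      ordering⇒satisfying ≤-refl φ k (≤-trans (≤-reflexive (length-positions (suc d) k)) b≤) ordering)

theorem6 : (k : ℕ) → .{{_ : NonZero k}} → W[1]-hard (CompatibleBoundedOrdering k)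
-- A positive number of pairs supplies the label `zero` that is given to every vertex.
theorem6 (suc k) P (d , P≤WSat) = WSat-≤fpt d P zero P≤WSat
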